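{- For every $\varepsilon > 0$ there exists: (a) a graph $G$ with $\chi(G)=4$ such that $\mathrm{pw}(G) < 2/\sqrt{3} + \varepsilon$; (b) a graph $G$ with $\chi(G)=5$ such that $\mathrm{pw}(G) < \sqrt{2} + \varepsilon$; (c) a graph $G$ with $\chi(G)=8$ such that $\mathrm{pw}(G) < 2 + \varepsilon$.
   Context: All graphs are finite, simple and undirected. Let $d$ be the Euclidean distance in the plane. A realization of a graph $G=(V,E)$ is a (not necessarily injective) function $r: V \to \mathbb{R}^2$ such that $d(r(u),r(v)) \ge 1$ for every edge $\{u,v\} \in E$. The width of a realization is the maximum of $d(r(u),r(v))$ over all $u,v \in V$. The plane-width $\mathrm{pw}(G)$ is the minimum width of all realizations of $G$. $\chi(G)$ denotes the chromatic number. -}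

module Defs where

open import Algebra.Bundles using (CommutativeRing)
import Algebra.Properties.Ring
import Algebra.Solver.Ring.NaturalCoefficients.Default
open import Axiom.ExcludedMiddle using (ExcludedMiddle)
open import Data.Empty using (⊥-elim)
open import Data.Fin.Base using (Fin)
import Data.Nat.Base as ℕ
open import Data.Product.Base using (Σ; ∃; ∃-syntax; _×_; _,_; proj₁; proj₂)
open import Data.Sum.Base using (_⊎_; inj₁; inj₂)
open import Level using (0ℓ)
open import Relation.Binary.Core using (Rel)
open import Relation.Binary.Definitions using (Symmetric; Irreflexive)
import Relation.Binary.Construct.NonStrictToStrict
open import Relation.Binary.PropositionalEquality.Core using (_≡_; _≢_)
open import Relation.Binary.Structures using (IsTotalOrder)
open import Relation.Nullary using (¬_; yes; no)
open import Relation.Unary using (Pred; Satisfiable)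

record Graph : Set₁ where
  field
    order  : ℕ.ℕ
    _~_    : Rel (Fin order) 0ℓ
    ~-sym  : Symmetric _~_
    ~-irr  : Irreflexive _≡_ _~_

  Vertex : Set
  Vertex = Fin order

Colourable : Graph → ℕ.ℕ → Set
Colourable G k = Σ (Vertex → Fin k) λ c → ∀ {u v} → u ~ v → c u ≢ c v
  where open Graph G

IsChromaticNumber : Graph → ℕ.ℕ → Set
IsChromaticNumber G k = Colourable G k × (∀ j → Colourable G j → k ℕ.≤ j)

-- The standard library has no real numbers.  They are given here by the usual
-- categorical axioms: a real number system is an ordered field in which every
-- nonempty set that is bounded above has a least upper bound.  Any two such systems
-- are isomorphic, so a statement about all of them is a statement about ℝ.
record Reals : Set₁ where
  infix 4 _≤_
  infix 8 _⁻¹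

  field
    commutativeRing : CommutativeRing 0ℓ 0ℓ

  open CommutativeRing commutativeRing public
    renaming (Carrier to ℝ)
    hiding (zero)

  field
    _≤_          : Rel ℝ 0ℓ
    isTotalOrder : IsTotalOrder _≈_ _≤_
    +-monoʳ-≤    : ∀ z {x y} → x ≤ y → z + x ≤ z + y
    *-nonNeg     : ∀ {x y} → 0# ≤ x → 0# ≤ y → 0# ≤ x * y
    1≉0          : ¬ (1# ≈ 0#)
    -- The value of the inverse at zero is left unspecified.
    _⁻¹          : ℝ → ℝ
    ⁻¹-inverseʳ  : ∀ {x} → ¬ (x ≈ 0#) → x * x ⁻¹ ≈ 1#

  IsUpperBound : Pred ℝ 0ℓ → ℝ → Set
  IsUpperBound S b = ∀ x → S x → x ≤ b

  IsLeastUpperBound : Pred ℝ 0ℓ → ℝ → Set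
  IsLeastUpperBound S b = IsUpperBound S b × (∀ c → IsUpperBound S c → b ≤ c)

  field
    complete : ∀ S → Satisfiable S → ∃ (IsUpperBound S) → ∃ (IsLeastUpperBound S)

  open Relation.Binary.Construct.NonStrictToStrict _≈_ _≤_ public using (_<_)

  IsMaximum : Pred ℝ 0ℓ → ℝ → Set
  IsMaximum S m = S m × (∀ x → S x → x ≤ m)

  IsMinimum : Pred ℝ 0ℓ → ℝ → Set
  IsMinimum S m = S m × (∀ x → S x → m ≤ x)

  2# : ℝ
  2# = 1# + 1#

  3# : ℝ
  3# = 2# + 1#

module RealProperties (R : Reals) where
  open Reals R
  open IsTotalOrder isTotalOrder public
    using (total; antisym)
    renaming (refl to ≤-refl; trans to ≤-trans; reflexive to ≤-reflexive)
  private module RP = Algebra.Properties.Ring ring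
  open Algebra.Solver.Ring.NaturalCoefficients.Default commutativeSemiring
    using (solve; _:+_; _:*_; _:=_)

  ≤-respˡ : ∀ {x y z} → x ≈ y → x ≤ z → y ≤ z
  ≤-respˡ e p = ≤-trans (≤-reflexive (sym e)) p

  ≤-respʳ : ∀ {x y z} → x ≈ y → z ≤ x → z ≤ y
  ≤-respʳ e p = ≤-trans p (≤-reflexive e)

  +-mono-≤ : ∀ {w x y z} → w ≤ x → y ≤ z → w + y ≤ x + z
  +-mono-≤ {w} {x} {y} {z} p q =
    ≤-trans (+-monoʳ-≤ w q)
      (≤-respˡ (+-comm z w) (≤-respʳ (+-comm z x) (+-monoʳ-≤ z p)))

  +-nonNeg : ∀ {x y} → 0# ≤ x → 0# ≤ y → 0# ≤ x + y
  +-nonNeg p q = ≤-respˡ (+-identityˡ 0#) (+-mono-≤ p q)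

  x≤x+y : ∀ {x y} → 0# ≤ y → x ≤ x + y
  x≤x+y {x} p = ≤-respˡ (+-identityʳ x) (+-monoʳ-≤ x p)

  +-minus : ∀ x y → y + (x - y) ≈ x
  +-minus x y = trans (+-congˡ (+-comm x (- y)))
    (trans (sym (+-assoc y (- y) x))
      (trans (+-congʳ (-‿inverseʳ y)) (+-identityˡ x)))

  0≤x-y : ∀ {x y} → y ≤ x → 0# ≤ x - y
  0≤x-y {x} {y} p =
    ≤-respˡ (-‿inverseˡ y) (≤-respʳ (+-comm (- y) x) (+-monoʳ-≤ (- y) p))

  +-cancelˡ-≤ : ∀ z {x y} → z + x ≤ z + y → x ≤ y
  +-cancelˡ-≤ z {x} {y} p = ≤-respˡ (lem x) (≤-respʳ (lem y) (+-monoʳ-≤ (- z) p))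
    where
    lem : ∀ w → - z + (z + w) ≈ w
    lem w = trans (sym (+-assoc (- z) z w))
      (trans (+-congʳ (-‿inverseˡ z)) (+-identityˡ w))

  *-monoʳ-≤ : ∀ {z x y} → 0# ≤ z → x ≤ y → z * x ≤ z * y
  *-monoʳ-≤ {z} {x} {y} p q =
    ≤-respʳ (trans (sym (distribˡ z x (y - x))) (*-congˡ (+-minus y x)))
      (x≤x+y (*-nonNeg p (0≤x-y q)))

  *-monoˡ-≤ : ∀ {z x y} → 0# ≤ z → x ≤ y → x * z ≤ y * z
  *-monoˡ-≤ {z} {x} {y} p q =
    ≤-respˡ (*-comm z x) (≤-respʳ (*-comm z y) (*-monoʳ-≤ p q))

  square-nonNeg : ∀ x → 0# ≤ x * x
  square-nonNeg x with total 0# x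
  ... | inj₁ p = *-nonNeg p p
  ... | inj₂ p = ≤-respʳ
          (trans (sym (RP.-‿distribˡ-* x (- x)))
            (trans (-‿cong (sym (RP.-‿distribʳ-* x x))) (RP.-‿involutive (x * x))))
          (*-nonNeg q q)
    where
    q : 0# ≤ - x
    q = ≤-respʳ (+-identityˡ (- x)) (0≤x-y p)

  0≤1 : 0# ≤ 1#
  0≤1 = ≤-respʳ (*-identityˡ 1#) (square-nonNeg 1#)

  ≥1⇒≉0 : ∀ {x} → 1# ≤ x → ¬ (x ≈ 0#)
  ≥1⇒≉0 p e = 1≉0 (antisym (≤-respʳ e p) 0≤1)

  ⁻¹-nonNeg : ∀ {x} → ¬ (x ≈ 0#) → 0# ≤ x → 0# ≤ x ⁻¹
  ⁻¹-nonNeg {x} x≉0 p = ≤-respʳ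
    (trans (sym (*-assoc x (x ⁻¹) (x ⁻¹)))
      (trans (*-congʳ (⁻¹-inverseʳ x≉0)) (*-identityˡ (x ⁻¹))))
    (*-nonNeg p (square-nonNeg (x ⁻¹)))

  *-⁻¹-cancel : ∀ x {y} → ¬ (y ≈ 0#) → (x * y) * y ⁻¹ ≈ x
  *-⁻¹-cancel x {y} y≉0 = trans (*-assoc x y (y ⁻¹))
    (trans (*-congˡ (⁻¹-inverseʳ y≉0)) (*-identityʳ x))

  ⁻¹-*-cancel : ∀ x {y} → ¬ (y ≈ 0#) → (x * y ⁻¹) * y ≈ x
  ⁻¹-*-cancel x {y} y≉0 = trans (*-assoc x (y ⁻¹) y)
    (trans (*-congˡ (trans (*-comm (y ⁻¹) y) (⁻¹-inverseʳ y≉0))) (*-identityʳ x))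

  square-cancel-≤ : ExcludedMiddle 0ℓ →
                    ∀ {x y} → 0# ≤ y → x * x ≤ y * y → x ≤ y
  square-cancel-≤ em {x} {y} 0≤y p with em {x ≤ y}
  ... | yes q = q
  ... | no ¬q with total x y
  ...   | inj₁ q = q
  ...   | inj₂ y≤x = ⊥-elim (h≉0 h≈0)
    where
    h : ℝ
    h = x - y
    0≤h : 0# ≤ h
    0≤h = 0≤x-y y≤x
    h≉0 : ¬ (h ≈ 0#)
    h≉0 e = ¬q (≤-reflexive (trans (sym (+-minus x y))
              (trans (+-congˡ e) (+-identityʳ y))))
    expand : (y + h) * (y + h) ≈ y * y + (h * h + (y + y) * h)
    expand = solve 2 (λ y h → (y :+ h) :* (y :+ h) :=
                              y :* y :+ (h :* h :+ (y :+ y) :* h)) refl y h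
    hh≤0 : h * h ≤ 0#
    hh≤0 = +-cancelˡ-≤ (y * y)
      (≤-respʳ (sym (+-identityʳ (y * y)))
        (≤-trans (+-monoʳ-≤ (y * y) (x≤x+y (*-nonNeg (+-nonNeg 0≤y 0≤y) 0≤h)))
          (≤-respˡ (trans (sym (*-cong (+-minus x y) (+-minus x y))) expand) p)))
    h≈0 : h ≈ 0#
    h≈0 = trans (sym (*-⁻¹-cancel h h≉0))
      (trans (*-congʳ (antisym hh≤0 (square-nonNeg h))) (zeroˡ (h ⁻¹)))

module SquareRoot (R : Reals) where
  open Reals R
  open RealProperties R
  open Algebra.Solver.Ring.NaturalCoefficients.Default commutativeSemiring
    using (solve; _:+_; _:*_; _:=_)

  -- For 0# ≤ a the negative numbers do not affect the least upper bound;
  -- allowing them makes √ total, with √ a ≈ 0# when a is negative.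
  SquareBelow : ℝ → Pred ℝ 0ℓ
  SquareBelow a x = x ≤ 0# ⊎ x * x ≤ a

  private
    bounded : ∀ a → IsUpperBound (SquareBelow a) (1# + a * a)
    bounded a x (inj₁ p) = ≤-trans p (+-nonNeg 0≤1 (square-nonNeg a))
    bounded a x (inj₂ p) with total x 1#
    ... | inj₁ q = ≤-trans q (x≤x+y (square-nonNeg a))
    ... | inj₂ q =
      ≤-trans x≤a (≤-trans (≤-respˡ (*-identityʳ a) (*-monoʳ-≤ 0≤a 1≤a))
        (≤-respʳ (+-comm (a * a) 1#) (x≤x+y 0≤1)))
      where
      x≤a : x ≤ a
      x≤a = ≤-trans (≤-respˡ (*-identityʳ x) (*-monoʳ-≤ (≤-trans 0≤1 q) q)) p
      1≤a : 1# ≤ a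
      1≤a = ≤-trans q x≤a
      0≤a : 0# ≤ a
      0≤a = ≤-trans 0≤1 1≤a

    supremum : ∀ a → ∃ (IsLeastUpperBound (SquareBelow a))
    supremum a = complete (SquareBelow a) (0# , inj₁ ≤-refl) (1# + a * a , bounded a)

  √ : ℝ → ℝ
  √ a = proj₁ (supremum a)

  √-isLeastUpperBound : ∀ a → IsLeastUpperBound (SquareBelow a) (√ a)
  √-isLeastUpperBound a = proj₂ (supremum a)

  √-nonNeg : ∀ a → 0# ≤ √ a
  √-nonNeg a = proj₁ (√-isLeastUpperBound a) 0# (inj₁ ≤-refl)

  √-square : ExcludedMiddle 0ℓ → ∀ {a} → 0# ≤ a → √ a * √ a ≈ a
  √-square em {a} 0≤a = antisym upper lower
    where
    s : ℝ
    s = √ a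
    0≤s : 0# ≤ s
    0≤s = √-nonNeg a
    0≤2s : 0# ≤ s + s
    0≤2s = +-nonNeg 0≤s 0≤s

    nonPos : ∀ {x δ} → x + δ ≤ x → δ ≤ 0#
    nonPos {x} p = +-cancelˡ-≤ x (≤-respʳ (sym (+-identityʳ x)) p)

    lower : a ≤ s * s
    lower with total a (s * s)
    ... | inj₁ p = p
    ... | inj₂ p =
      ≤-respˡ (+-minus a (s * s))
        (≤-respʳ (+-identityʳ (s * s)) (+-monoʳ-≤ (s * s) g≤0))
      where
      g D δ : ℝ
      g = a - s * s
      D = (s + s + 1#) + g
      δ = g * D ⁻¹
      0≤g : 0# ≤ g
      0≤g = 0≤x-y p
      1≤2s+1 : 1# ≤ s + s + 1#
      1≤2s+1 = ≤-respʳ (+-comm 1# (s + s)) (x≤x+y 0≤2s)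
      1≤D : 1# ≤ D
      1≤D = ≤-trans 1≤2s+1 (x≤x+y 0≤g)
      D≉0 : ¬ (D ≈ 0#)
      D≉0 = ≥1⇒≉0 1≤D
      0≤D⁻¹ : 0# ≤ D ⁻¹
      0≤D⁻¹ = ⁻¹-nonNeg D≉0 (≤-trans 0≤1 1≤D)
      0≤δ : 0# ≤ δ
      0≤δ = *-nonNeg 0≤g 0≤D⁻¹
      δ≤1 : δ ≤ 1#
      δ≤1 = ≤-respʳ (⁻¹-inverseʳ D≉0) (*-monoˡ-≤ 0≤D⁻¹
              (≤-respʳ (+-comm g (s + s + 1#))
                (x≤x+y (≤-trans 0≤1 1≤2s+1))))
      δ-bound : δ * (s + s + δ) ≤ g
      δ-bound = ≤-respʳ (⁻¹-*-cancel g D≉0)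
        (*-monoʳ-≤ 0≤δ (≤-trans (+-monoʳ-≤ (s + s) δ≤1) (x≤x+y 0≤g)))
      expand : s * s + δ * (s + s + δ) ≈ (s + δ) * (s + δ)
      expand = solve 2 (λ s δ → s :* s :+ δ :* (s :+ s :+ δ) :=
                                (s :+ δ) :* (s :+ δ)) refl s δ
      s+δ-below : (s + δ) * (s + δ) ≤ a
      s+δ-below = ≤-respˡ expand
        (≤-respʳ (+-minus a (s * s)) (+-monoʳ-≤ (s * s) δ-bound))
      δ≤0 : δ ≤ 0#
      δ≤0 = nonPos (proj₁ (√-isLeastUpperBound a) (s + δ) (inj₂ s+δ-below))
      g≤0 : g ≤ 0#
      g≤0 = ≤-respˡ (⁻¹-*-cancel g D≉0)
        (≤-respʳ (zeroˡ D) (*-monoˡ-≤ (≤-trans 0≤1 1≤D) δ≤0))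

    upper : s * s ≤ a
    upper with total (s * s) a
    ... | inj₁ p = p
    ... | inj₂ p =
      ≤-respˡ (+-minus (s * s) a) (≤-respʳ (+-identityʳ a) (+-monoʳ-≤ a g≤0))
      where
      g D δ t : ℝ
      g = s * s - a
      D = s + s + 1#
      δ = g * D ⁻¹
      t = s - δ
      0≤g : 0# ≤ g
      0≤g = 0≤x-y p
      1≤D : 1# ≤ D
      1≤D = ≤-respʳ (+-comm 1# (s + s)) (x≤x+y 0≤2s)
      0≤D : 0# ≤ D
      0≤D = ≤-trans 0≤1 1≤D
      D≉0 : ¬ (D ≈ 0#)
      D≉0 = ≥1⇒≉0 1≤D
      0≤D⁻¹ : 0# ≤ D ⁻¹
      0≤D⁻¹ = ⁻¹-nonNeg D≉0 0≤D
      0≤δ : 0# ≤ δ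
      0≤δ = *-nonNeg 0≤g 0≤D⁻¹
      g≤ss : g ≤ s * s
      g≤ss = ≤-respʳ (trans (+-comm g a) (+-minus (s * s) a)) (x≤x+y 0≤a)
      s≤D : s ≤ D
      s≤D = ≤-trans (x≤x+y 0≤s) (x≤x+y 0≤1)
      δ≤s : δ ≤ s
      δ≤s = ≤-respʳ (*-⁻¹-cancel s D≉0)
        (*-monoˡ-≤ 0≤D⁻¹ (≤-trans g≤ss (*-monoʳ-≤ 0≤s s≤D)))
      0≤t : 0# ≤ t
      0≤t = 0≤x-y δ≤s
      t+δ≈s : t + δ ≈ s
      t+δ≈s = trans (+-comm t δ) (+-minus s δ)
      t≤s : t ≤ s
      t≤s = ≤-respʳ t+δ≈s (x≤x+y 0≤δ)
      δ-bound : δ * (t + (t + δ)) ≤ g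
      δ-bound = ≤-respʳ (⁻¹-*-cancel g D≉0) (*-monoʳ-≤ 0≤δ
        (≤-trans (+-mono-≤ t≤s (≤-reflexive t+δ≈s)) (x≤x+y 0≤1)))
      expand : (t + δ) * (t + δ) ≈ δ * (t + (t + δ)) + t * t
      expand = solve 2 (λ t δ → (t :+ δ) :* (t :+ δ) :=
                                δ :* (t :+ (t :+ δ)) :+ t :* t) refl t δ
      a≤tt : a ≤ t * t
      a≤tt = +-cancelˡ-≤ g (≤-respˡ
        (trans (trans (sym expand) (*-cong t+δ≈s t+δ≈s))
          (trans (sym (+-minus (s * s) a)) (+-comm a g)))
        (+-mono-≤ δ-bound ≤-refl))
      g≤0 : g ≤ 0#
      g≤0 = ≤-respˡ (⁻¹-*-cancel g D≉0) (≤-respʳ (zeroˡ D) (*-monoˡ-≤ 0≤D δ≤0))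
        where
        t-upper : IsUpperBound (SquareBelow a) t
        t-upper x (inj₁ q) = ≤-trans q 0≤t
        t-upper x (inj₂ q) = square-cancel-≤ em 0≤t (≤-trans q a≤tt)
        δ≤0 : δ ≤ 0#
        δ≤0 = nonPos (≤-respˡ (sym t+δ≈s) (proj₂ (√-isLeastUpperBound a) t t-upper))

module PlaneWidth (R : Reals) where
  open Reals R
  open SquareRoot R using (√)

  Point : Set
  Point = ℝ × ℝ

  dist : Point → Point → ℝ
  dist (x₁ , y₁) (x₂ , y₂) =
    √ ((x₁ - x₂) * (x₁ - x₂) + (y₁ - y₂) * (y₁ - y₂))

  module _ (G : Graph) where
    open Graph G

    IsRealization : (Vertex → Point) → Set
    IsRealization r = ∀ {u v} → u ~ v → 1# ≤ dist (r u) (r v)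

    -- The maximum is over all pairs of vertices, adjacent or not; only the graph
    -- with no vertices has realizations without a width.
    IsWidth : (Vertex → Point) → ℝ → Set
    IsWidth r = IsMaximum (λ x → ∃[ u ] ∃[ v ] x ≈ dist (r u) (r v))

    IsPlaneWidth : ℝ → Set
    IsPlaneWidth = IsMinimum (λ w → ∃[ r ] (IsRealization r × IsWidth r w))

{-# OPTIONS --safe #-}
module Submission where

-- Why it is true.  Let n be 3, 4 or 6 and let κ be the circumradius of the regular
-- n-gon with sides of length 1, so that 2 κ is 2/√3, √2 or 2.  Take a circle of radius
-- ρ slightly larger than κ.  On it, points whose angular distance is at least 2π/n, or
-- falls short of that by very little, have distance at least 1.  Let σ be the rotation
-- by 2π/(nM) for a large M, and P i the image of one point of the circle under the
-- i-th power of σ.  Join two points when their distance is at least 1.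
--
-- Suppose that finitely many P i, namely those with i at most nM, are coloured with n
-- colours.  The points P i, P (i+M), ..., P (i+(n-1)M) are pairwise joined, and P (i+1)
-- is joined to all of them but P i.  The pigeonhole principle gives P i and P (i+1) the
-- same colour, so P 0 and P M have the same colour, although they are joined.  So the
-- graph is not n-colourable (sequence-uncolourable, circle-uncolourable; these lemmas have
-- n + 2 in the place of n, as the argument needs at least two colours).  For n = 6 the
-- radius is at least 1, so the centre of the circle can be added, joined to everything,
-- and a further colour is needed (addOrigin-uncolourable).
--
-- Removing vertices one by one lowers the chromatic number by at most 1 at a time, so
-- some induced subgraph has the chromatic number required (subset-chromatic).  The
-- points themselves realize it with width at most 2 ρ, and 2 ρ is as close to 2 κ as
-- desired.
--
-- It remains to see that the minimum in the definition of the plane-width is attained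
-- (planeWidth-exists).  This is a compactness argument: realizations whose widths
-- approach the infimum have a cluster point, found one coordinate at a time as the
-- upper limit of the coordinate (cluster, clusters).
--
-- The rotation σ is obtained without trigonometry by halving the angle of a rotation ω
-- by 2π/n repeatedly.  Each halving at least halves 1 - cos, so that the infimum of
-- 1 - cos over all roots of ω is zero (small-root).

open import Defs
open import Algebra.Bundles using (CommutativeRing)
import Algebra.Properties.AbelianGroup
import Algebra.Properties.Ring
import Algebra.Properties.Semiring.Mult.TCOptimised
import Algebra.Solver.Ring
open import Algebra.Solver.Ring.AlmostCommutativeRing
  using (fromCommutativeRing; _-Raw-AlmostCommutative⟶_)
open import Axiom.ExcludedMiddle using (ExcludedMiddle)
open import Data.Empty using (⊥; ⊥-elim)
open import Data.Fin.Base as Fin using (Fin; zero; suc; toℕ; inject≤; punchOut)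
open import Data.Fin.Properties
  using (inject≤-injective; pigeonhole; punchOut-injective; suc-injective; toℕ<n; toℕ-fromℕ<)
open import Data.Integer.Base as ℤ using (ℤ; -[1+_]; _⊖_; _◃_)
  renaming (+_ to pos)
import Data.Integer.Properties as ℤ
open import Data.Maybe.Base using (Maybe; just; nothing)
open import Data.Nat.Base as ℕ using (ℕ; zero; suc; z≤n; s≤s)
open import Data.Nat.DivMod using (_mod_; m<n⇒m%n≡m)
import Data.Nat.Properties as ℕ
import Data.Nat.Solver as ℕ
open import Data.Product.Base using (∃; ∃-syntax; _×_; _,_; proj₁; proj₂)
import Data.Sign.Base as Sign
open import Data.Sum.Base using (_⊎_; inj₁; inj₂)
open import Function.Base using (_∘_)
open import Level using (0ℓ)
open import Relation.Binary.Core using (Rel)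
open import Relation.Binary.PropositionalEquality.Core as ≡ using (_≡_; _≢_)
import Relation.Binary.Reasoning.Setoid
open import Relation.Nullary using (¬_; yes; no)
open import Relation.Unary using (Pred; Satisfiable)

-- Ring identities

-- Ring normalisation with integer coefficients, so that identities that involve
-- subtraction are decided.
module IntegerSolver (R : CommutativeRing 0ℓ 0ℓ) where
  open CommutativeRing R
  open Algebra.Properties.Ring ring
  open Algebra.Properties.AbelianGroup +-abelianGroup using (⁻¹-∙-comm)
  open Algebra.Properties.Semiring.Mult.TCOptimised semiring
    renaming (_×_ to _·_)
  open Relation.Binary.Reasoning.Setoid setoid

  private
    ⟦_⟧ : ℤ → Carrier
    ⟦ pos n ⟧    = n · 1#
    ⟦ -[1+ n ] ⟧ = - (suc n · 1#)

    neg-homo : ∀ i → ⟦ ℤ.- i ⟧ ≈ - ⟦ i ⟧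
    neg-homo (pos zero)    = sym -0#≈0#
    neg-homo (pos (suc n)) = refl
    neg-homo -[1+ n ]      = sym (-‿involutive _)

    ⊖-homo : ∀ m n → ⟦ m ⊖ n ⟧ ≈ m · 1# - n · 1#
    ⊖-homo zero    zero    = sym (-‿inverseʳ 0#)
    ⊖-homo zero    (suc n) = sym (+-identityˡ _)
    ⊖-homo (suc m) zero    = sym (trans (+-congˡ -0#≈0#) (+-identityʳ _))
    ⊖-homo (suc m) (suc n) = begin
      ⟦ suc m ⊖ suc n ⟧                   ≡⟨ ≡.cong ⟦_⟧ (ℤ.[1+m]⊖[1+n]≡m⊖n m n) ⟩
      ⟦ m ⊖ n ⟧                           ≈⟨ ⊖-homo m n ⟩
      a - b                               ≈⟨ +-congʳ (+-identityʳ a) ⟨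
      (a + 0#) - b                        ≈⟨ +-congʳ (+-congˡ (-‿inverseʳ 1#)) ⟨
      (a + (1# - 1#)) - b                 ≈⟨ +-congʳ (+-assoc a 1# (- 1#)) ⟨
      ((a + 1#) - 1#) - b                 ≈⟨ +-assoc (a + 1#) (- 1#) (- b) ⟩
      (a + 1#) + (- 1# - b)               ≈⟨ +-cong (+-comm a 1#) (⁻¹-∙-comm 1# b) ⟩
      (1# + a) - (1# + b)                 ≈⟨ +-cong (1+× m 1#) (-‿cong (1+× n 1#)) ⟨
      suc m · 1# - suc n · 1#             ∎
      where
      a = m · 1#
      b = n · 1#

    +-homo : ∀ i j → ⟦ i ℤ.+ j ⟧ ≈ ⟦ i ⟧ + ⟦ j ⟧
    +-homo (pos m)  (pos n)  = ×-homo-+ 1# m n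
    +-homo (pos m)  -[1+ n ] = ⊖-homo m (suc n)
    +-homo -[1+ m ] (pos n)  = trans (⊖-homo n (suc m)) (+-comm _ _)
    +-homo -[1+ m ] -[1+ n ] = begin
      - (suc (suc (m ℕ.+ n)) · 1#)        ≈⟨ -‿cong (1+× (suc (m ℕ.+ n)) 1#) ⟩
      - (1# + (suc m ℕ.+ n) · 1#)         ≈⟨ -‿cong (+-congˡ (×-homo-+ 1# (suc m) n)) ⟩
      - (1# + (suc m · 1# + n · 1#))      ≈⟨ -‿cong (+-assoc 1# _ _) ⟨
      - ((1# + suc m · 1#) + n · 1#)      ≈⟨ -‿cong (+-congʳ (+-comm 1# _)) ⟩
      - ((suc m · 1# + 1#) + n · 1#)      ≈⟨ -‿cong (+-assoc _ 1# _) ⟩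
      - (suc m · 1# + (1# + n · 1#))      ≈⟨ -‿cong (+-congˡ (1+× n 1#)) ⟨
      - (suc m · 1# + suc n · 1#)         ≈⟨ ⁻¹-∙-comm _ _ ⟨
      - (suc m · 1#) - suc n · 1#         ∎

    neg-◃ : ∀ n → ⟦ Sign.- ◃ n ⟧ ≈ - (n · 1#)
    neg-◃ zero    = sym -0#≈0#
    neg-◃ (suc n) = refl

    *-homo : ∀ i j → ⟦ i ℤ.* j ⟧ ≈ ⟦ i ⟧ * ⟦ j ⟧
    *-homo (pos m)  (pos n)  =
      trans (reflexive (≡.cong ⟦_⟧ (ℤ.+◃n≡+n (m ℕ.* n)))) (×1-homo-* m n)
    *-homo (pos m)  -[1+ n ] = trans (neg-◃ (m ℕ.* suc n))
      (trans (-‿cong (×1-homo-* m (suc n))) (-‿distribʳ-* _ _))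
    *-homo -[1+ m ] (pos n)  = trans (neg-◃ (suc m ℕ.* n))
      (trans (-‿cong (×1-homo-* (suc m) n)) (-‿distribˡ-* _ _))
    *-homo -[1+ m ] -[1+ n ] = begin
      (suc m ℕ.* suc n) · 1#           ≈⟨ ×1-homo-* (suc m) (suc n) ⟩
      suc m · 1# * (suc n · 1#)        ≈⟨ -‿involutive _ ⟨
      - - (suc m · 1# * (suc n · 1#))  ≈⟨ -‿cong (-‿distribʳ-* _ _) ⟩
      - (suc m · 1# * - (suc n · 1#))  ≈⟨ -‿distribˡ-* _ _ ⟩
      - (suc m · 1#) * - (suc n · 1#)  ∎

    morphism : ℤ.+-*-rawRing -Raw-AlmostCommutative⟶ fromCommutativeRing R
    morphism = record
      { ⟦_⟧    = ⟦_⟧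
      ; +-homo = +-homo
      ; *-homo = *-homo
      ; -‿homo = neg-homo
      ; 0-homo = refl
      ; 1-homo = refl
      }

    coefficients≟ : ∀ i j → Maybe (⟦ i ⟧ ≈ ⟦ j ⟧)
    coefficients≟ i j with i ℤ.≟ j
    ... | yes eq = just (reflexive (≡.cong ⟦_⟧ eq))
    ... | no  _  = nothing

  open Algebra.Solver.Ring ℤ.+-*-rawRing (fromCommutativeRing R) morphism coefficients≟
    public using (solve; _:=_; _:+_; _:*_; _:-_; :-_; con; Polynomial)

  -- These evaluate to 0# and 1# themselves.
  nil one : ∀ {n} → Polynomial n
  nil = con (pos 0)
  one = con (pos 1)

-- Order, infima and compactness

module Order (R : Reals) (em : ExcludedMiddle 0ℓ) where
  open Reals R
  open RealProperties R
  open IntegerSolver commutativeRing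

  -- The proof obligation d ≈ y - x is one for the ring solver.
  ≤-by : ∀ {x y d} → 0# ≤ d → d ≈ y - x → x ≤ y
  ≤-by {x} {y} 0≤d e = ≤-respʳ (trans (+-congˡ e) (+-minus y x)) (x≤x+y 0≤d)

  ≰⇒> : ∀ {x y} → ¬ (x ≤ y) → y < x
  ≰⇒> {x} {y} x≰y with total x y
  ... | inj₁ x≤y = ⊥-elim (x≰y x≤y)
  ... | inj₂ y≤x = y≤x , λ e → x≰y (≤-reflexive (sym e))

  ≰⇒≥ : ∀ {x y} → ¬ (x ≤ y) → y ≤ x
  ≰⇒≥ x≰y = proj₁ (≰⇒> x≰y)

  <⇒≱ : ∀ {x y} → x < y → ¬ (y ≤ x)
  <⇒≱ (x≤y , x≉y) y≤x = x≉y (antisym x≤y y≤x)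

  ≤-<-trans : ∀ {x y z} → x ≤ y → y < z → x < z
  ≤-<-trans x≤y y<z = ≰⇒> λ z≤x → <⇒≱ y<z (≤-trans z≤x x≤y)

  <-≤-trans : ∀ {x y z} → x < y → y ≤ z → x < z
  <-≤-trans x<y y≤z = ≰⇒> λ z≤x → <⇒≱ x<y (≤-trans y≤z z≤x)

  <-respʳ : ∀ {x y z} → x ≈ y → z < x → z < y
  <-respʳ e (z≤x , z≉x) = ≤-respʳ e z≤x , λ z≈y → z≉x (trans z≈y (sym e))

  x<x+y : ∀ {x y} → 0# < y → x < x + y
  x<x+y {x} {y} (0≤y , 0≉y) = x≤x+y 0≤y , λ e → 0≉y
    (trans (sym (-‿inverseʳ x)) (trans (+-congʳ e)
      (solve 2 (λ x y → (x :+ y) :- x := y) refl x y)))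

  0<y-x : ∀ {x y} → x < y → 0# < y - x
  0<y-x {x} {y} (x≤y , x≉y) = 0≤x-y x≤y , λ e →
    x≉y (trans (sym (+-identityʳ x)) (trans (+-congˡ e) (+-minus y x)))

  x+y≰x : ∀ {x y} → 0# < y → ¬ (x + y ≤ x)
  x+y≰x 0<y = <⇒≱ (x<x+y 0<y)

  x≰x-y : ∀ {x y} → 0# < y → ¬ (x ≤ x - y)
  x≰x-y {x} {y} 0<y p = <⇒≱ 0<y (≤-by (0≤x-y p)
    (solve 2 (λ x y → (x :- y) :- x := nil :- y) refl x y))

  *-pos : ∀ {x y} → 0# < x → 0# < y → 0# < x * y
  *-pos {x} {y} (0≤x , 0≉x) (0≤y , 0≉y) = *-nonNeg 0≤x 0≤y , λ e →
    0≉x (trans (sym (zeroˡ (y ⁻¹)))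
      (trans (*-congʳ e) (*-⁻¹-cancel x λ y≈0 → 0≉y (sym y≈0))))

  >0⇒≉0 : ∀ {x} → 0# < x → ¬ (x ≈ 0#)
  >0⇒≉0 (_ , 0≉x) e = 0≉x (sym e)

  ⁻¹-pos : ∀ {x} → 0# < x → 0# < x ⁻¹
  ⁻¹-pos {x} 0<x = ⁻¹-nonNeg x≉0 (proj₁ 0<x) , λ 0≈x⁻¹ → 1≉0
    (trans (sym (⁻¹-inverseʳ x≉0)) (trans (*-congˡ (sym 0≈x⁻¹)) (zeroʳ x)))
    where x≉0 = >0⇒≉0 0<x

  0<1 : 0# < 1#
  0<1 = 0≤1 , λ e → 1≉0 (sym e)

  0<2 : 0# < 2#
  0<2 = ≤-<-trans 0≤1 (x<x+y 0<1)

  ½ : ℝ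
  ½ = 2# ⁻¹

  0<½ : 0# < ½
  0<½ = ⁻¹-pos 0<2

  ½+½≈1 : ½ + ½ ≈ 1#
  ½+½≈1 = trans (solve 1 (λ h → h :+ h := (one :+ one) :* h) refl ½)
    (⁻¹-inverseʳ (>0⇒≉0 0<2))

  halves : ∀ x → ½ * x + ½ * x ≈ x
  halves x = trans (sym (distribʳ x ½ ½)) (trans (*-congʳ ½+½≈1) (*-identityˡ x))

  half-pos : ∀ {x} → 0# < x → 0# < ½ * x
  half-pos = *-pos 0<½

  ½x≤x : ∀ {x} → 0# ≤ x → ½ * x ≤ x
  ½x≤x {x} 0≤x = ≤-respʳ (halves x) (x≤x+y (*-nonNeg (proj₁ 0<½) 0≤x))

  x+x≤x⇒x≤0 : ∀ {x} → x + x ≤ x → x ≤ 0#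
  x+x≤x⇒x≤0 {x} p = +-cancelˡ-≤ x (≤-respʳ (sym (+-identityʳ x)) p)

  ≤-limit : ∀ {x y} → (∀ ε → 0# < ε → x ≤ y + ε) → x ≤ y
  -- Were y < x, half the difference would be too small a value of ε.
  ≤-limit {x} {y} p with em {x ≤ y}
  ... | yes x≤y = x≤y
  ... | no  x≰y = ⊥-elim (x+y≰x (half-pos 0<d) (≤-by (0≤x-y (p (½ * d) (half-pos 0<d))) eq))
    where
    d = x - y
    0<d : 0# < d
    0<d = 0<y-x (≰⇒> x≰y)
    eq : (y + ½ * d) - x ≈ ½ * d - (½ * d + ½ * d)
    eq = trans (solve 3 (λ x y h → (y :+ h) :- x := h :- (x :- y)) refl x y (½ * d))
           (+-congˡ (-‿cong (sym (halves d))))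

  ≤-limit-* : ∀ {x y k} → 0# < k → (∀ ε → 0# < ε → x ≤ y + k * ε) → x ≤ y
  ≤-limit-* {k = k} 0<k p = ≤-limit λ ε 0<ε → ≤-respʳ
    (+-congˡ (trans (sym (*-assoc k (k ⁻¹) ε))
      (trans (*-congʳ (⁻¹-inverseʳ (>0⇒≉0 0<k))) (*-identityˡ ε))))
    (p (k ⁻¹ * ε) (*-pos (⁻¹-pos 0<k) 0<ε))

  -- The infimum is the least upper bound of the lower bounds.
  infimum : (S : Pred ℝ 0ℓ) → Satisfiable S → ∀ b → (∀ x → S x → b ≤ x) →
            ∃[ g ] ((∀ x → S x → g ≤ x) ×
                    (∀ ε → 0# < ε → ∃[ x ] (S x × x ≤ g + ε)))
  infimum S (s , Ss) b lower = g , (λ x Sx → proj₂ g-lub x λ l Ll → Ll x Sx) , approach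
    where
    Lower : Pred ℝ 0ℓ
    Lower l = ∀ x → S x → l ≤ x
    sup = complete Lower (b , lower) (s , λ l Ll → Ll s Ss)
    g = proj₁ sup
    g-lub = proj₂ sup
    approach : ∀ ε → 0# < ε → ∃[ x ] (S x × x ≤ g + ε)
    approach ε 0<ε with em {∃[ x ] (S x × x ≤ g + ε)}
    ... | yes found = found
    ... | no  none  = ⊥-elim (x+y≰x 0<ε (proj₁ g-lub (g + ε)
            λ x Sx → ≰⇒≥ λ x≤g+ε → none (x , Sx , x≤g+ε)))

  -- x is within ε of c.
  Near : ℝ → ℝ → ℝ → Set
  Near ε c x = c - ε ≤ x × x ≤ c + ε

  Near-mono : ∀ {δ ε c x} → δ ≤ ε → Near δ c x → Near ε c x
  Near-mono {δ} {ε} {c} δ≤ε (p , q) =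
    ≤-trans (≤-by (0≤x-y δ≤ε)
      (solve 3 (λ d e c → e :- d := (c :- d) :- (c :- e)) refl δ ε c)) p ,
    ≤-trans q (+-monoʳ-≤ c δ≤ε)

  module _ {X : Set} where

    -- A family of nonempty sets that decreases as its positive index tends to zero.
    record Shrinking (F : ℝ → Pred X 0ℓ) : Set where
      field
        monotone  : ∀ {δ ε} → δ ≤ ε → ∀ x → F δ x → F ε x
        satisfied : ∀ {ε} → 0# < ε → ∃[ x ] F ε x

    -- One coordinate f of a family that is eventually bounded has a cluster value c: the
    -- elements with coordinate near c form a shrinking family again.
    cluster : ∀ F → Shrinking F → (f : X → ℝ) → ∀ b → (∀ x → F 1# x → Near b 0# (f x)) →
              ∃[ c ] Shrinking (λ ε x → F ε x × Near ε c (f x))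
    cluster F shrinking f b bound = c , record
      { monotone  = λ δ≤ε x (Fx , near) → monotone δ≤ε x Fx , Near-mono δ≤ε near
      ; satisfied = approach
      }
      where
      open Shrinking shrinking

      below : ∀ {δ ε} → 0# < δ → 0# < ε → ∃[ μ ] (0# < μ × μ ≤ δ × μ ≤ ε)
      below {δ} {ε} 0<δ 0<ε with total δ ε
      ... | inj₁ δ≤ε = δ , 0<δ , ≤-refl , δ≤ε
      ... | inj₂ ε≤δ = ε , 0<ε , ε≤δ , ≤-refl

      -- The least upper bound of this set is the upper limit of f along the family.
      Below : Pred ℝ 0ℓ
      Below t = ∀ {ε} → 0# < ε → ∃[ x ] (F ε x × t ≤ f x)

      lowest : Below (0# - b)
      -- Coordinates are bounded only for indices up to 1, so the index is lowered to 1.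
      lowest 0<ε = let (μ , 0<μ , μ≤1 , μ≤ε) = below 0<1 0<ε
                       (x , Fx) = satisfied 0<μ
                   in x , monotone μ≤ε x Fx , proj₁ (bound x (monotone μ≤1 x Fx))

      highest : ∀ t → Below t → t ≤ 0# + b
      highest t Bt = let (x , Fx , t≤) = Bt 0<1 in ≤-trans t≤ (proj₂ (bound x Fx))

      sup = complete Below (0# - b , lowest) (0# + b , highest)
      c = proj₁ sup
      c-lub = proj₂ sup

      module _ {ε} (0<ε : 0# < ε) where
        eventually-below : ∃[ δ ] (0# < δ × (∀ x → F δ x → f x ≤ c + ε))
        eventually-below with em {∃[ δ ] (0# < δ × (∀ x → F δ x → f x ≤ c + ε))}
        ... | yes found = found
        ... | no  none  = ⊥-elim (x+y≰x 0<ε (proj₁ c-lub (c + ε) above))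
          where
          above : Below (c + ε)
          above {δ} 0<δ with em {∃[ x ] (F δ x × c + ε ≤ f x)}
          ... | yes found = found
          ... | no  none′ = ⊥-elim (none (δ , 0<δ , λ x Fx →
                  ≰⇒≥ λ c+ε≤ → none′ (x , Fx , c+ε≤)))

        frequently-above : Below (c - ε)
        frequently-above with em {∃[ t ] (Below t × c - ε ≤ t)}
        ... | yes (t , Bt , c-ε≤t) = λ 0<δ →
                let (x , Fx , t≤) = Bt 0<δ in x , Fx , ≤-trans c-ε≤t t≤
        ... | no  none = ⊥-elim (x≰x-y 0<ε (proj₂ c-lub (c - ε) λ t Bt →
                ≰⇒≥ λ c-ε≤t → none (t , Bt , c-ε≤t)))

        approach : ∃[ x ] (F ε x × Near ε c (f x))
        approach =
          let (δ , 0<δ , bounded) = eventually-below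
              (μ , 0<μ , μ≤δ , μ≤ε) = below 0<δ 0<ε
              (x , Fx , c-ε≤) = frequently-above 0<μ
          in x , monotone μ≤ε x Fx , c-ε≤ , bounded x (monotone μ≤δ x Fx)

    -- Any finite number of bounded coordinates have simultaneous cluster values.
    clusters : ∀ F → Shrinking F → ∀ n (f : Fin n → X → ℝ) →
               ∀ b → (∀ x → F 1# x → ∀ i → Near b 0# (f i x)) →
               ∃ λ (c : Fin n → ℝ) →
                 Shrinking (λ ε x → F ε x × (∀ i → Near ε (c i) (f i x)))
    clusters F shrinking zero f b bound = (λ ()) , record
      { monotone  = λ δ≤ε x (Fx , _) → monotone δ≤ε x Fx , λ ()
      ; satisfied = λ 0<ε → let (x , Fx) = satisfied 0<ε in x , Fx , λ ()
      }
      where open Shrinking shrinking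
    clusters F shrinking (suc n) f b bound = c⁺ , record
      { monotone  = λ δ≤ε x (Fx , near) →
                      Shrinking.monotone shrinking δ≤ε x Fx , λ i → Near-mono δ≤ε (near i)
      ; satisfied = λ 0<ε →
          let (x , (Fx , near₀) , near) = Shrinking.satisfied (proj₂ rest) 0<ε
          in x , Fx , λ { zero → near₀ ; (suc i) → near i }
      }
      where
      first = cluster F shrinking (f zero) b (λ x Fx → bound x Fx zero)
      F₁ : ℝ → Pred X 0ℓ
      F₁ ε x = F ε x × Near ε (proj₁ first) (f zero x)
      rest = clusters F₁ (proj₂ first) n (λ i → f (suc i)) b
               (λ x F₁x i → bound x (proj₁ F₁x) (suc i))
      c⁺ : Fin (suc n) → ℝ
      c⁺ zero    = proj₁ first
      c⁺ (suc i) = proj₁ rest i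

-- Distances and the existence of the plane-width

module Distance (R : Reals) (em : ExcludedMiddle 0ℓ) where
  open Reals R
  open RealProperties R
  open SquareRoot R
  open PlaneWidth R
  open IntegerSolver commutativeRing
  open Order R em

  √-mono-≤ : ∀ {a b} → a ≤ b → √ a ≤ √ b
  √-mono-≤ {a} {b} a≤b = proj₂ (√-isLeastUpperBound a) (√ b) λ where
    x (inj₁ x≤0)  → ≤-trans x≤0 (√-nonNeg b)
    x (inj₂ xx≤a) → proj₁ (√-isLeastUpperBound b) x (inj₂ (≤-trans xx≤a a≤b))

  √-cong : ∀ {a b} → a ≈ b → √ a ≈ √ b
  √-cong e = antisym (√-mono-≤ (≤-reflexive e)) (√-mono-≤ (≤-reflexive (sym e)))

  -- The square of the distance.
  sqDist : Point → Point → ℝ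
  sqDist p q = (proj₁ p - proj₁ q) * (proj₁ p - proj₁ q) +
               (proj₂ p - proj₂ q) * (proj₂ p - proj₂ q)

  sqDist-nonNeg : ∀ p q → 0# ≤ sqDist p q
  sqDist-nonNeg p q = +-nonNeg (square-nonNeg _) (square-nonNeg _)

  dist-nonNeg : ∀ p q → 0# ≤ dist p q
  dist-nonNeg p q = √-nonNeg (sqDist p q)

  dist-square : ∀ p q → dist p q * dist p q ≈ sqDist p q
  dist-square p q = √-square em (sqDist-nonNeg p q)

  dist-≤ : ∀ p q {w} → 0# ≤ w → sqDist p q ≤ w * w → dist p q ≤ w
  dist-≤ p q 0≤w le = square-cancel-≤ em 0≤w (≤-respˡ (sym (dist-square p q)) le)

  dist-≥1 : ∀ p q → 1# ≤ sqDist p q → 1# ≤ dist p q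
  dist-≥1 p q le = square-cancel-≤ em (dist-nonNeg p q)
    (≤-respˡ (sym (*-identityˡ 1#)) (≤-respʳ (sym (dist-square p q)) le))

  dist-sym : ∀ p q → dist p q ≈ dist q p
  dist-sym (a , b) (c , d) = √-cong (+-cong (swap a c) (swap b d))
    where
    swap : ∀ x y → (x - y) * (x - y) ≈ (y - x) * (y - x)
    swap = solve 2 (λ x y → (x :- y) :* (x :- y) := (y :- x) :* (y :- x)) refl

  dist-self : ∀ p → dist p p ≤ 0#
  dist-self p@(a , b) = dist-≤ p p ≤-refl (≤-reflexive (solve 2 (λ a b →
    (a :- a) :* (a :- a) :+ (b :- b) :* (b :- b) := nil :* nil) refl a b))

  4# : ℝ
  4# = 2# + 2#

  0<4 : 0# < 4#
  0<4 = <-≤-trans 0<2 (x≤x+y (proj₁ 0<2))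

  -- Subtraction of points as vectors.
  _⊝_ : Point → Point → Point
  (a , b) ⊝ (c , d) = a - c , b - d

  dist-translate : ∀ p q o → dist (p ⊝ o) (q ⊝ o) ≈ dist p q
  dist-translate (a , b) (c , d) (e , f) =
    √-cong (+-cong (*-cong (shift a c e) (shift a c e)) (*-cong (shift b d f) (shift b d f)))
    where
    shift : ∀ x y z → (x - z) - (y - z) ≈ x - y
    shift = solve 3 (λ x y z → (x :- z) :- (y :- z) := x :- y) refl

  square-≤⇒Near : ∀ {x d} → 0# ≤ d → x * x ≤ d * d → Near d 0# x
  square-≤⇒Near {x} {d} 0≤d p =
    ≤-by (0≤x-y (square-cancel-≤ em 0≤d
      (≤-respˡ (solve 1 (λ x → x :* x := (:- x) :* (:- x)) refl x) p)))
      (solve 2 (λ x d → d :- (:- x) := x :- (nil :- d)) refl x d) ,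
    ≤-respʳ (sym (+-identityˡ d)) (square-cancel-≤ em 0≤d p)

  differences-≤-dist : ∀ p q → Near (dist p q) 0# (proj₁ p - proj₁ q) ×
                               Near (dist p q) 0# (proj₂ p - proj₂ q)
  differences-≤-dist p q =
    square-≤⇒Near (dist-nonNeg p q) (≤-respʳ (sym (dist-square p q)) (x≤x+y (square-nonNeg _))) ,
    square-≤⇒Near (dist-nonNeg p q) (≤-respʳ (sym (dist-square p q))
      (≤-respʳ (+-comm _ _) (x≤x+y (square-nonNeg _))))

  Near-sym : ∀ {ε x y} → Near ε x y → Near ε y x
  Near-sym {ε} {x} {y} (p , q) =
    ≤-by (0≤x-y q) (solve 3 (λ e x y → x :+ e :- y := x :- (y :- e)) refl ε x y) ,
    ≤-by (0≤x-y p) (solve 3 (λ e x y → y :- (x :- e) := y :+ e :- x) refl ε x y)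

  Near-- : ∀ {ε x x′ y y′} → Near ε x x′ → Near ε y y′ → Near (ε + ε) (x - y) (x′ - y′)
  Near-- {ε} {x} {x′} {y} {y′} (p , q) (r , s) =
    ≤-by (+-nonNeg (0≤x-y p) (0≤x-y s)) (solve 5 (λ e x x′ y y′ →
      x′ :- (x :- e) :+ (y :+ e :- y′) := x′ :- y′ :- (x :- y :- (e :+ e))) refl ε x x′ y y′) ,
    ≤-by (+-nonNeg (0≤x-y q) (0≤x-y r)) (solve 5 (λ e x x′ y y′ →
      x :+ e :- x′ :+ (y′ :- (y :- e)) := x :- y :+ (e :+ e) :- (x′ :- y′)) refl ε x x′ y y′)

  -- With h = y - x, the two terms x * h and h * h of the expansion of y * y are at most
  -- d * k and k * k.
  square-near : ∀ {d k x y} → Near d 0# x → Near k x y →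
                y * y ≤ x * x + (2# * d * k + k * k)
  square-near {d} {k} {x} {y} (p , q) (r , s) = ≤-by
    (+-nonNeg (+-nonNeg (*-nonNeg (0≤x-y q) (0≤x-y r)) (*-nonNeg (0≤x-y p) (0≤x-y s)))
              (*-nonNeg (0≤x-y r) (0≤x-y s)))
    (solve 4 (λ d k x y →
      ((nil :+ d) :- x) :* (y :- (x :- k)) :+ (x :- (nil :- d)) :* ((x :+ k) :- y)
        :+ (y :- (x :- k)) :* ((x :+ k) :- y)
      := (x :* x :+ ((one :+ one) :* d :* k :+ k :* k)) :- y :* y)
      refl d k x y)

  -- Moving each of the four coordinates by at most ε changes the distance by at most 4 ε.
  dist-near : ∀ {ε} p q p′ q′ → 0# ≤ ε →
              Near ε (proj₁ p) (proj₁ p′) × Near ε (proj₂ p) (proj₂ p′) →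
              Near ε (proj₁ q) (proj₁ q′) × Near ε (proj₂ q) (proj₂ q′) →
              dist p′ q′ ≤ dist p q + 4# * ε
  dist-near {ε} p q p′ q′ 0≤ε (px , py) (qx , qy) =
    ≤-respʳ (+-congˡ 2k≈4ε) (dist-≤ p′ q′ (+-nonNeg 0≤d (+-nonNeg 0≤k 0≤k))
      (≤-trans (+-mono-≤ (square-near (proj₁ bounds) (Near-- px qx))
                         (square-near (proj₂ bounds) (Near-- py qy)))
        (≤-by (+-nonNeg (*-nonNeg 0≤k 0≤k) (*-nonNeg 0≤k 0≤k)) eq)))
    where
    d = dist p q
    k = ε + ε
    x = proj₁ p - proj₁ q
    y = proj₂ p - proj₂ q
    0≤d = dist-nonNeg p q
    0≤k = +-nonNeg 0≤ε 0≤ε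
    bounds = differences-≤-dist p q
    2k≈4ε : k + k ≈ 4# * ε
    2k≈4ε = solve 1 (λ ε → (ε :+ ε) :+ (ε :+ ε) := ((one :+ one) :+ (one :+ one)) :* ε) refl ε
    -- The equation d * d ≈ x * x + y * y enters as a summand that is equal to zero.
    eq : k * k + k * k ≈ (d + (k + k)) * (d + (k + k)) -
           (x * x + (2# * d * k + k * k) + (y * y + (2# * d * k + k * k)))
    eq = trans (solve 4 (λ d k x² y² → k :* k :+ k :* k :=
             (d :+ (k :+ k)) :* (d :+ (k :+ k)) :-
             (x² :+ ((one :+ one) :* d :* k :+ k :* k) :+
               (y² :+ ((one :+ one) :* d :* k :+ k :* k)))
               :+ (x² :+ y² :- d :* d)) refl d k (x * x) (y * y))
           (trans (+-congˡ (trans (+-congʳ (sym (dist-square p q))) (-‿inverseʳ (d * d))))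
             (+-identityʳ _))

  maximum : ∀ {n} → Fin n → (f : Fin n → ℝ) → ∃[ i ] (∀ j → f j ≤ f i)
  maximum {suc zero}    _ f = zero , λ { zero → ≤-refl }
  maximum {suc (suc n)} _ f with i , max ← maximum zero (λ j → f (suc j)) =
    larger (total (f zero) (f (suc i)))
    where
    larger : f zero ≤ f (suc i) ⊎ f (suc i) ≤ f zero → ∃[ i ] (∀ j → f j ≤ f i)
    larger (inj₁ f₀≤fᵢ) = suc i , λ { zero → f₀≤fᵢ ; (suc j) → max j }
    larger (inj₂ fᵢ≤f₀) = zero , λ { zero → ≤-refl ; (suc j) → ≤-trans (max j) fᵢ≤f₀ }

  -- The vertex o guarantees that there are vertices, so that widths exist; it also serves
  -- as the origin of coordinates.
  module _ (G : Graph) (o : Graph.Vertex G) where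
    open Graph G

    width-exists : ∀ r → ∃[ w ] IsWidth G r w
    width-exists r = dist (r u) (r (partner u)) ,
      (u , partner u , refl) ,
      λ { x (u′ , v′ , e) → ≤-respˡ (sym e) (≤-trans (partner-max u′ v′) (proj₂ best u′)) }
      where
      partner : Vertex → Vertex
      partner u = proj₁ (maximum o (λ v → dist (r u) (r v)))
      partner-max : ∀ u v → dist (r u) (r v) ≤ dist (r u) (r (partner u))
      partner-max u = proj₂ (maximum o (λ v → dist (r u) (r v)))
      best = maximum o (λ u → dist (r u) (r (partner u)))
      u = proj₁ best

    width-≤ : ∀ {r w b} → IsWidth G r w → (∀ u v → dist (r u) (r v) ≤ b) → w ≤ b
    width-≤ ((u , v , e) , _) bound = ≤-respˡ (sym e) (bound u v)

    -- A limit of realizations whose widths approach the infimum g is a realization of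
    -- width at most g.
    planeWidth-exists : ∀ {r b} → IsRealization G r → (∀ u v → dist (r u) (r v) ≤ b) →
                        ∃[ w ] (IsPlaneWidth G w × w ≤ b)
    planeWidth-exists {r₀} {b} real₀ bound₀ =
      w , ((limit , limit-real , limit-width) , λ x Sx → ≤-trans w≤g (g≤ x Sx)) , ≤-trans w≤g g≤b
      where
      Width : Pred ℝ 0ℓ
      Width w = ∃[ r ] (IsRealization G r × IsWidth G r w)

      S₀ : Width (proj₁ (width-exists r₀))
      S₀ = r₀ , real₀ , proj₂ (width-exists r₀)

      width-nonNeg : ∀ x → Width x → 0# ≤ x
      width-nonNeg x (r , _ , (u , v , e) , _) = ≤-respʳ (sym e) (dist-nonNeg (r u) (r v))

      inf = infimum Width (proj₁ (width-exists r₀) , S₀) 0# width-nonNeg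
      g = proj₁ inf
      g≤ = proj₁ (proj₂ inf)

      g≤b : g ≤ b
      g≤b = ≤-trans (g≤ _ S₀) (width-≤ (proj₂ (width-exists r₀)) bound₀)

      F : ℝ → Pred (Vertex → Point) 0ℓ
      F ε r = IsRealization G r × (∀ u v → dist (r u) (r v) ≤ g + ε)

      F-shrinking : Shrinking F
      F-shrinking = record
        { monotone  = λ δ≤ε r (real , bound) →
            real , λ u v → ≤-trans (bound u v) (+-monoʳ-≤ g δ≤ε)
        ; satisfied = λ {ε} 0<ε →
            let (x , (r , real , _ , max) , x≤) = proj₂ (proj₂ inf) ε 0<ε
            in r , real , λ u v → ≤-trans (max _ (u , v , refl)) x≤
        }

      -- Coordinates relative to the image of o are bounded by the width.
      x-coord y-coord : Vertex → (Vertex → Point) → ℝ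
      x-coord v r = proj₁ (r v ⊝ r o)
      y-coord v r = proj₂ (r v ⊝ r o)

      xs = clusters F F-shrinking order x-coord (g + 1#) λ r Fr v →
        Near-mono (proj₂ Fr v o) (proj₁ (differences-≤-dist (r v) (r o)))
      F₁ : ℝ → Pred (Vertex → Point) 0ℓ
      F₁ ε r = F ε r × (∀ v → Near ε (proj₁ xs v) (x-coord v r))
      ys = clusters F₁ (proj₂ xs) order y-coord (g + 1#) λ r F₁r v →
        Near-mono (proj₂ (proj₁ F₁r) v o) (proj₂ (differences-≤-dist (r v) (r o)))

      limit : Vertex → Point
      limit v = proj₁ xs v , proj₁ ys v

      approximate : ∀ {ε} → 0# < ε → ∃[ r ] (F ε r ×
        (∀ v → Near ε (proj₁ (limit v)) (x-coord v r) ×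
               Near ε (proj₂ (limit v)) (y-coord v r)))
      approximate 0<ε = let (r , (Fr , near-x) , near-y) = Shrinking.satisfied (proj₂ ys) 0<ε
                        in r , Fr , λ v → near-x v , near-y v

      limit-real : IsRealization G limit
      limit-real {u} {v} u~v = ≤-limit-* 0<4 λ ε 0<ε →
        let (r , (real , _) , near) = approximate 0<ε
        in ≤-trans (≤-respʳ (sym (dist-translate (r u) (r v) (r o))) (real u~v))
             (dist-near (limit u) (limit v) (r u ⊝ r o) (r v ⊝ r o) (proj₁ 0<ε)
               (near u) (near v))

      limit-bound : ∀ u v → dist (limit u) (limit v) ≤ g
      limit-bound u v = ≤-limit-* {k = 1# + 4#} 0<5 λ ε 0<ε →
        let (r , (_ , bound) , near) = approximate 0<ε
        in ≤-trans
             (dist-near (r u ⊝ r o) (r v ⊝ r o) (limit u) (limit v) (proj₁ 0<ε)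
               (Near-sym (proj₁ (near u)) , Near-sym (proj₂ (near u)))
               (Near-sym (proj₁ (near v)) , Near-sym (proj₂ (near v))))
             (≤-respʳ (collect g ε 4#)
               (≤-respˡ (+-comm _ _) (≤-respʳ (+-comm _ _)
                 (+-monoʳ-≤ (4# * ε)
                   (≤-respˡ (sym (dist-translate (r u) (r v) (r o))) (bound u v))))))
        where
        0<5 : 0# < 1# + 4#
        0<5 = <-≤-trans 0<4 (≤-respʳ (+-comm 4# 1#) (x≤x+y 0≤1))
        collect : ∀ g ε k → (g + ε) + k * ε ≈ g + (1# + k) * ε
        collect = solve 3 (λ g ε k → (g :+ ε) :+ k :* ε := g :+ (one :+ k) :* ε) refl

      w = proj₁ (width-exists limit)
      limit-width = proj₂ (width-exists limit)

      w≤g : w ≤ g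
      w≤g = width-≤ limit-width limit-bound

-- Colourings

Colourable-mono : ∀ G {j k} → j ℕ.≤ k → Colourable G j → Colourable G k
Colourable-mono G j≤k (c , proper) =
  (λ v → inject≤ (c v) j≤k) , λ u~v e → proper u~v (inject≤-injective j≤k j≤k _ _ e)

-- The numbers from 0 to (n + 2) M stand for points placed around a circle, M of them for
-- each of n + 2 equal arcs.  Two of them are joined, by hypothesis, if they differ by k M
-- or by k M - 1 with 0 < k < n + 2.
module _ (_~_ : Rel ℕ 0ℓ) (n M : ℕ)
         (multiple : ∀ i k → k ℕ.< suc n → i ~ (i ℕ.+ suc k ℕ.* M))
         (multiple⁻ : ∀ i k → k ℕ.< suc n → suc i ~ (i ℕ.+ suc k ℕ.* M))
         (c : ℕ → Fin (suc (suc n)))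
         (proper : ∀ {i j} → i ℕ.≤ suc (suc n) ℕ.* M → j ℕ.≤ suc (suc n) ℕ.* M →
                   i ~ j → c i ≢ c j) where

  private
    in-range : ∀ {i k} → i ℕ.≤ M → k ℕ.< suc (suc n) →
               i ℕ.+ k ℕ.* M ℕ.≤ suc (suc n) ℕ.* M
    in-range i≤M k<n = ℕ.≤-trans (ℕ.+-monoˡ-≤ _ i≤M) (ℕ.*-monoˡ-≤ M k<n)

    start : ∀ i → i ℕ.+ 0 ℕ.* M ≡ i
    start = ℕ.+-identityʳ

    distinct : ∀ {i j k} → i ℕ.≤ M → j ℕ.< k → k ℕ.< suc (suc n) →
               c (i ℕ.+ j ℕ.* M) ≢ c (i ℕ.+ k ℕ.* M)
    distinct {i} {j} i≤M j<k k<n with d , ≡.refl ← ℕ.m≤n⇒∃[o]m+o≡n j<k =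
      proper (in-range i≤M (ℕ.<-trans j<k k<n)) (in-range i≤M k<n)
        (≡.subst ((i ℕ.+ j ℕ.* M) ~_) (shift i j d)
          (multiple (i ℕ.+ j ℕ.* M) d (ℕ.≤-trans (s≤s (ℕ.m≤n+m d j)) (ℕ.≤-pred k<n))))
      where
      shift : ∀ i j d → (i ℕ.+ j ℕ.* M) ℕ.+ suc d ℕ.* M ≡ i ℕ.+ (suc j ℕ.+ d) ℕ.* M
      shift i j d = solve 4 (λ i j d M →
        (i :+ j :* M) :+ (con 1 :+ d) :* M := i :+ (con 1 :+ j :+ d) :* M) ≡.refl i j d M
        where open ℕ.+-*-Solver

    -- Among i + 1 and the n + 2 numbers i + k M, only i + 1 and i need not be joined, so
    -- the coincidence of colours given by the pigeonhole principle is theirs.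
    step : ∀ i → i ℕ.< M → c (suc i) ≡ c i
    step i i<M = conclude (pigeonhole (ℕ.n<1+n _) (c ∘ f))
      where
      f : Fin (suc (suc (suc n))) → ℕ
      f zero    = suc i
      f (suc a) = i ℕ.+ toℕ a ℕ.* M

      conclude : (∃[ a ] ∃[ b ] (a Fin.< b × c (f a) ≡ c (f b))) → c (suc i) ≡ c i
      conclude (zero , suc zero , _ , e) = ≡.trans e (≡.cong c (start i))
      conclude (zero , suc (suc b) , _ , e) =
        ⊥-elim (proper (ℕ.≤-trans i<M (ℕ.m≤m+n M _)) (in-range (ℕ.<⇒≤ i<M) (toℕ<n (suc b)))
          (multiple⁻ i (toℕ b) (toℕ<n b)) e)
      conclude (suc a , suc b , s≤s a<b , e) = ⊥-elim (distinct (ℕ.<⇒≤ i<M) a<b (toℕ<n b) e)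

    constant : ∀ i → i ℕ.≤ M → c i ≡ c 0
    constant zero    _   = ≡.refl
    constant (suc i) i<M = ≡.trans (step i i<M) (constant i (ℕ.<⇒≤ i<M))

  wrapped-uncolourable : ⊥
  wrapped-uncolourable = distinct {0} {0} {1} z≤n (s≤s z≤n) (s≤s (s≤s z≤n))
    (≡.sym (≡.trans (≡.cong c (ℕ.+-identityʳ M)) (constant M ℕ.≤-refl)))

-- Graphs on finite sets of points

module DistanceGraph (R : Reals) (em : ExcludedMiddle 0ℓ) where
  open Reals R
  open RealProperties R
  open PlaneWidth R
  open IntegerSolver commutativeRing
  open Order R em
  open Distance R em

  -- Vertices are joined when their points have distance at least 1, so that p itself is a
  -- realization.
  distanceGraph : ∀ {n} → (Fin n → Point) → Graph
  distanceGraph {n} p = record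
    { order = n
    ; _~_   = λ u v → 1# ≤ dist (p u) (p v)
    ; ~-sym = λ {u} {v} → ≤-respʳ (dist-sym (p u) (p v))
    ; ~-irr = λ { {u} ≡.refl le → 1≉0 (antisym (≤-trans le (dist-self (p u))) 0≤1) }
    }

  -- The additional point, with index zero, gets a colour of its own.
  Colourable-suc : ∀ {n} (p : Fin (suc n) → Point) {k} →
                   Colourable (distanceGraph (p ∘ suc)) k → Colourable (distanceGraph p) (suc k)
  Colourable-suc p (c , proper) = c⁺ , λ {u} {v} → proper⁺ u v
    where
    c⁺ : Fin _ → Fin _
    c⁺ zero    = zero
    c⁺ (suc v) = suc (c v)
    proper⁺ : ∀ u v → 1# ≤ dist (p u) (p v) → c⁺ u ≢ c⁺ v
    proper⁺ zero    zero    u~v e = Graph.~-irr (distanceGraph p) {zero} ≡.refl u~v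
    proper⁺ (suc u) (suc v) u~v e = proper u~v (suc-injective e)

  -- Points are dropped until the rest is k-colourable for the first time; the last point
  -- dropped is put back.  Properties P of all points are inherited.
  subset-chromatic : ∀ {n} (p : Fin n → Point) (P : Pred Point 0ℓ) → (∀ v → P (p v)) →
                     ∀ k → ¬ Colourable (distanceGraph p) k →
                     ∃[ m ] ∃ λ (q : Fin m → Point) →
                       (∀ v → P (q v)) × IsChromaticNumber (distanceGraph q) (suc k)
  subset-chromatic {zero}  p P Pp k uncolourable = ⊥-elim (uncolourable ((λ ()) , λ { {()} }))
  subset-chromatic {suc n} p P Pp k uncolourable with em {Colourable (distanceGraph (p ∘ suc)) k}
  ... | yes colourable = suc n , p , Pp , Colourable-suc p colourable , λ j coloured →
          ℕ.≰⇒> λ j≤k → uncolourable (Colourable-mono (distanceGraph p) j≤k coloured)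
  ... | no uncolourable′ = subset-chromatic (p ∘ suc) P (Pp ∘ suc) k uncolourable′

  -- The square of the Euclidean norm.
  norm² : Point → ℝ
  norm² (x , y) = x * x + y * y

  -- By the parallelogram law.
  dist-≤-diameter : ∀ {ρ} p q → 0# ≤ ρ → norm² p ≤ ρ * ρ → norm² q ≤ ρ * ρ →
                    dist p q ≤ ρ + ρ
  dist-≤-diameter {ρ} p@(a , b) q@(c , d) 0≤ρ p≤ q≤ = dist-≤ p q (+-nonNeg 0≤ρ 0≤ρ)
    (≤-by (+-nonNeg (+-nonNeg (square-nonNeg (a + c)) (square-nonNeg (b + d)))
                    (+-nonNeg (+-nonNeg (0≤x-y p≤) (0≤x-y p≤)) (+-nonNeg (0≤x-y q≤) (0≤x-y q≤))))
      (solve 5 (λ r a b c d →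
        (a :+ c) :* (a :+ c) :+ (b :+ d) :* (b :+ d) :+
          ((r :* r :- (a :* a :+ b :* b) :+ (r :* r :- (a :* a :+ b :* b))) :+
           (r :* r :- (c :* c :+ d :* d) :+ (r :* r :- (c :* c :+ d :* d))))
        := (r :+ r) :* (r :+ r) :- ((a :- c) :* (a :- c) :+ (b :- d) :* (b :- d)))
      refl ρ a b c d))

  chromatic-in-disc : ∀ {n} (p : Fin n → Point) {ρ} → 0# ≤ ρ → (∀ v → norm² (p v) ≤ ρ * ρ) →
                      ∀ k → ¬ Colourable (distanceGraph p) k →
                      ∃[ G ] (IsChromaticNumber G (suc k) ×
                              ∃[ w ] (IsPlaneWidth G w × w ≤ ρ + ρ))
  chromatic-in-disc p {ρ} 0≤ρ p≤ρ k uncolourable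
    with subset-chromatic p (λ x → norm² x ≤ ρ * ρ) p≤ρ k uncolourable
  ... | zero  , q , _ , _ , minimal = ⊥-elim (ℕ.n≮0 (minimal 0 ((λ ()) , λ { {()} })))
  ... | suc m , q , q≤ρ , χ = distanceGraph q , χ ,
          planeWidth-exists (distanceGraph q) zero (λ u~v → u~v)
            (λ u v → dist-≤-diameter (q u) (q v) 0≤ρ (q≤ρ u) (q≤ρ v))

  origin : Point
  origin = 0# , 0#

  addOrigin : ∀ {n} → (Fin n → Point) → Fin (suc n) → Point
  addOrigin p zero    = origin
  addOrigin p (suc v) = p v

  -- The origin is joined to all points, so its colour is not used by them.
  addOrigin-uncolourable : ∀ {n} (p : Fin n → Point) → (∀ v → 1# ≤ norm² (p v)) →
                           ∀ {k} → ¬ Colourable (distanceGraph p) k →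
                           ¬ Colourable (distanceGraph (addOrigin p)) (suc k)
  addOrigin-uncolourable p 1≤p uncolourable (c , proper) = uncolourable
    ((λ v → punchOut (distinct v)) , λ {u} {v} u~v e →
      proper {suc u} {suc v} u~v (punchOut-injective (distinct u) (distinct v) e))
    where
    distinct : ∀ v → c zero ≢ c (suc v)
    distinct v = proper {zero} {suc v}
      (dist-≥1 origin (p v) (≤-respʳ (sym (from-origin _ _)) (1≤p v)))
      where
      from-origin : ∀ x y → (0# - x) * (0# - x) + (0# - y) * (0# - y) ≈ x * x + y * y
      from-origin = solve 2 (λ x y →
        (nil :- x) :* (nil :- x) :+ (nil :- y) :* (nil :- y) := x :* x :+ y :* y) refl

  module _ (P : ℕ → Point) (n M : ℕ)
           (multiple : ∀ i k → k ℕ.< suc n → 1# ≤ dist (P i) (P (i ℕ.+ suc k ℕ.* M)))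
           (multiple⁻ : ∀ i k → k ℕ.< suc n →
                        1# ≤ dist (P (suc i)) (P (i ℕ.+ suc k ℕ.* M))) where

    sequence-uncolourable :
      ¬ Colourable (distanceGraph {suc (suc (suc n) ℕ.* M)} (P ∘ toℕ)) (suc (suc n))
    sequence-uncolourable (c , proper) =
      -- Only the values of i mod L at i < L matter; there it is i itself.
      wrapped-uncolourable _~_ n M multiple multiple⁻ (λ i → c (i mod L)) λ i≤ j≤ i~j →
        proper (≡.subst₂ _~_ (≡.sym (toℕ-mod (s≤s i≤))) (≡.sym (toℕ-mod (s≤s j≤))) i~j)
      where
      _~_ : Rel ℕ 0ℓ
      i ~ j = 1# ≤ dist (P i) (P j)
      L : ℕ
      L = suc (suc (suc n) ℕ.* M)
      toℕ-mod : ∀ {i} → i ℕ.< L → toℕ (i mod L) ≡ i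
      toℕ-mod {i} i<L = ≡.trans (toℕ-fromℕ< _) (m<n⇒m%n≡m i<L)

-- Points as complex numbers

module Rotation (R : Reals) (em : ExcludedMiddle 0ℓ) where
  open Reals R
  open RealProperties R
  open SquareRoot R
  open PlaneWidth R
  open IntegerSolver commutativeRing
  open Order R em
  open Distance R em
  open DistanceGraph R em

  -- Equality of coordinates.
  infix 4 _≋_
  _≋_ : Point → Point → Set
  p ≋ q = proj₁ p ≈ proj₁ q × proj₂ p ≈ proj₂ q

  ≋-refl : ∀ {p} → p ≋ p
  ≋-refl = refl , refl

  ≋-sym : ∀ {p q} → p ≋ q → q ≋ p
  ≋-sym (e , f) = sym e , sym f

  ≋-trans : ∀ {p q r} → p ≋ q → q ≋ r → p ≋ r
  ≋-trans (e , f) (e′ , f′) = trans e e′ , trans f f′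

  -- Multiplication of complex numbers.
  infixl 7 _⊛_
  _⊛_ : Point → Point → Point
  (a , b) ⊛ (c , d) = a * c - b * d , a * d + b * c

  ⊛-cong : ∀ {p p′ q q′} → p ≋ p′ → q ≋ q′ → p ⊛ q ≋ p′ ⊛ q′
  ⊛-cong (e , f) (g , h) =
    +-cong (*-cong e g) (-‿cong (*-cong f h)) , +-cong (*-cong e h) (*-cong f g)

  ⊛-assoc : ∀ p q r → (p ⊛ q) ⊛ r ≋ p ⊛ (q ⊛ r)
  ⊛-assoc (a , b) (c , d) (e , f) =
    solve 6 (λ a b c d e f → (a :* c :- b :* d) :* e :- (a :* d :+ b :* c) :* f
      := a :* (c :* e :- d :* f) :- b :* (c :* f :+ d :* e)) refl a b c d e f ,
    solve 6 (λ a b c d e f → (a :* c :- b :* d) :* f :+ (a :* d :+ b :* c) :* e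
      := a :* (c :* f :+ d :* e) :+ b :* (c :* e :- d :* f)) refl a b c d e f

  ⊛-comm : ∀ p q → p ⊛ q ≋ q ⊛ p
  ⊛-comm (a , b) (c , d) =
    solve 4 (λ a b c d → a :* c :- b :* d := c :* a :- d :* b) refl a b c d ,
    solve 4 (λ a b c d → a :* d :+ b :* c := c :* b :+ d :* a) refl a b c d

  𝟙 : Point
  𝟙 = 1# , 0#

  ⊛-identityˡ : ∀ p → 𝟙 ⊛ p ≋ p
  ⊛-identityˡ (a , b) =
    solve 2 (λ a b → one :* a :- nil :* b := a) refl a b ,
    solve 2 (λ a b → one :* b :+ nil :* a := b) refl a b

  ⊛-identityʳ : ∀ p → p ⊛ 𝟙 ≋ p
  ⊛-identityʳ p = ≋-trans (⊛-comm p 𝟙) (⊛-identityˡ p)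

  norm²-⊛ : ∀ p q → norm² (p ⊛ q) ≈ norm² p * norm² q
  norm²-⊛ (a , b) (c , d) = solve 4 (λ a b c d →
    (a :* c :- b :* d) :* (a :* c :- b :* d) :+ (a :* d :+ b :* c) :* (a :* d :+ b :* c)
    := (a :* a :+ b :* b) :* (c :* c :+ d :* d)) refl a b c d

  sqDist-⊛ : ∀ z p q → sqDist (z ⊛ p) (z ⊛ q) ≈ norm² z * sqDist p q
  sqDist-⊛ (a , b) (c , d) (e , f) = trans
    (+-cong (*-cong (re c d e f) (re c d e f)) (*-cong (im c d e f) (im c d e f)))
    (norm²-⊛ (a , b) (c - e , d - f))
    where
    re : ∀ c d e f → (a * c - b * d) - (a * e - b * f) ≈ a * (c - e) - b * (d - f)
    re = solve 6 (λ a b c d e f → (a :* c :- b :* d) :- (a :* e :- b :* f)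
      := a :* (c :- e) :- b :* (d :- f)) refl a b
    im : ∀ c d e f → (a * d + b * c) - (a * f + b * e) ≈ a * (d - f) + b * (c - e)
    im = solve 6 (λ a b c d e f → (a :* d :+ b :* c) :- (a :* f :+ b :* e)
      := a :* (d :- f) :+ b :* (c :- e)) refl a b

  sqDist-cong : ∀ {p p′ q q′} → p ≋ p′ → q ≋ q′ → sqDist p q ≈ sqDist p′ q′
  sqDist-cong (e , f) (g , h) = +-cong (*-cong x x) (*-cong y y)
    where
    x = +-cong e (-‿cong g)
    y = +-cong f (-‿cong h)

  pow : Point → ℕ → Point
  pow z zero    = 𝟙
  pow z (suc n) = z ⊛ pow z n

  pow-cong : ∀ {z w} n → z ≋ w → pow z n ≋ pow w n
  pow-cong zero    e = ≋-refl
  pow-cong (suc n) e = ⊛-cong e (pow-cong n e)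

  pow-+ : ∀ z m n → pow z (m ℕ.+ n) ≋ pow z m ⊛ pow z n
  pow-+ z zero    n = ≋-sym (⊛-identityˡ _)
  pow-+ z (suc m) n = ≋-trans (⊛-cong ≋-refl (pow-+ z m n)) (≋-sym (⊛-assoc z (pow z m) (pow z n)))

  pow-* : ∀ z k n → pow z (k ℕ.* n) ≋ pow (pow z n) k
  pow-* z zero    n = ≋-refl
  pow-* z (suc k) n = ≋-trans (pow-+ z n (k ℕ.* n)) (⊛-cong ≋-refl (pow-* z k n))

  norm²-𝟙 : norm² 𝟙 ≈ 1#
  norm²-𝟙 = solve 0 (one :* one :+ nil :* nil := one) refl

  norm²-pow : ∀ {z} → norm² z ≈ 1# → ∀ n → norm² (pow z n) ≈ 1#
  norm²-pow e zero    = norm²-𝟙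
  norm²-pow {z} e (suc n) = trans (norm²-⊛ z (pow z n))
    (trans (*-cong e (norm²-pow e n)) (*-identityˡ 1#))

  Re : Point → ℝ
  Re = proj₁

  -- The three-term recurrence of the Chebyshev polynomials.
  Re-recurrence : ∀ {z} → norm² z ≈ 1# → ∀ n →
                  Re (pow z (2 ℕ.+ n)) ≈ (Re z + Re z) * Re (pow z (1 ℕ.+ n)) - Re (pow z n)
  Re-recurrence {c , s} e n = lemma (pow (c , s) n)
    where
    lemma : ∀ w → Re ((c , s) ⊛ ((c , s) ⊛ w)) ≈ (c + c) * Re ((c , s) ⊛ w) - Re w
    lemma (x , y) = trans
      (solve 4 (λ c s x y → c :* (c :* x :- s :* y) :- s :* (c :* y :+ s :* x)
        := (c :+ c) :* (c :* x :- s :* y) :- (c :* c :+ s :* s) :* x) refl c s x y)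
      (+-congˡ (-‿cong (trans (*-congʳ e) (*-identityˡ x))))

  -- The scalar product; for unit vectors, the cosine of the angle between them.
  _∙_ : Point → Point → ℝ
  (a , b) ∙ (c , d) = a * c + b * d

  sqDist-unit : ∀ p q → norm² p ≈ 1# → norm² q ≈ 1# → sqDist p q ≈ 2# - (p ∙ q + p ∙ q)
  sqDist-unit (a , b) (c , d) e f = trans
    (solve 4 (λ a b c d → (a :- c) :* (a :- c) :+ (b :- d) :* (b :- d) :=
      ((a :* a :+ b :* b) :+ (c :* c :+ d :* d)) :- ((a :* c :+ b :* d) :+ (a :* c :+ b :* d)))
      refl a b c d)
    (+-congʳ (+-cong e f))

  *-cancelˡ-≤ : ∀ {z x y} → 0# < z → z * x ≤ z * y → x ≤ y
  *-cancelˡ-≤ {z} {x} {y} 0<z p with em {x ≤ y}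
  ... | yes x≤y = x≤y
  ... | no  x≰y = ⊥-elim (<⇒≱ (*-pos 0<z 0<x-y)
        (≤-by (0≤x-y p) (solve 3 (λ z x y → z :* y :- z :* x := nil :- z :* (x :- y)) refl z x y)))
    where
    0<x-y : 0# < x - y
    0<x-y = 0<y-x (≰⇒> x≰y)

  -- A rotation z close to the identity hardly changes the real part of w.  The proof expands
  -- the squared norm of η w - (z - 1), which is nonnegative, and divides by 2 η.
  ∙-near-𝟙 : ∀ {η} z w → 0# < η → norm² z ≈ 1# → norm² w ≈ 1# →
             (1# - Re z) + (1# - Re z) ≤ η * η → z ∙ w ≤ Re w + η
  ∙-near-𝟙 {η} (a , b) (x , y) 0<η ez ew h = *-cancelˡ-≤ (<-≤-trans 0<η (x≤x+y (proj₁ 0<η)))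
    (≤-by (+-nonNeg (+-nonNeg (square-nonNeg (η * x - (a - 1#))) (square-nonNeg (η * y - b)))
                    (0≤x-y h))
      (trans
        (solve 5 (λ h a b x y →
          (h :* x :- (a :- one)) :* (h :* x :- (a :- one)) :+ (h :* y :- b) :* (h :* y :- b)
            :+ (h :* h :- ((one :- a) :+ (one :- a)))
          := ((h :+ h) :* (x :+ h) :- (h :+ h) :* (a :* x :+ b :* y))
            :+ (h :* h :* ((x :* x :+ y :* y) :- one) :+ ((a :* a :+ b :* b) :- one)))
          refl η a b x y)
        (trans (+-congˡ (trans (+-cong (trans (*-congˡ (minus-self ew)) (zeroʳ _)) (minus-self ez))
            (+-identityˡ 0#)))
          (+-identityʳ _))))
    where
    minus-self : ∀ {t} → t ≈ 1# → t - 1# ≈ 0#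
    minus-self e = trans (+-congʳ e) (-‿inverseʳ 1#)

  -- A unit vector σ in the closed upper half plane with a power equal to ω.
  record Root (ω : Point) (σ : Point) : Set where
    field
      upper    : 0# ≤ proj₂ σ
      unit     : norm² σ ≈ 1#
      exponent : ℕ
      power    : pow σ exponent ≋ ω

  square≤1⇒bounds : ∀ {c} → c * c ≤ 1# → 0# ≤ 1# + c × 0# ≤ 1# - c
  square≤1⇒bounds {c} cc≤1
    with p , q ← square-≤⇒Near {c} {1#} 0≤1 (≤-respʳ (sym (*-identityˡ 1#)) cc≤1) =
    ≤-respʳ (solve 1 (λ c → c :- (nil :- one) := one :+ c) refl c) (0≤x-y p) ,
    0≤x-y (≤-respʳ (+-identityˡ 1#) q)

  unit⇒square≤1 : ∀ c s → norm² (c , s) ≈ 1# → c * c ≤ 1#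
  unit⇒square≤1 c s e = ≤-respʳ e (x≤x+y (square-nonNeg s))

  square-injective : ∀ {x y} → 0# ≤ x → 0# ≤ y → x * x ≈ y * y → x ≈ y
  square-injective 0≤x 0≤y e =
    antisym (square-cancel-≤ em 0≤y (≤-reflexive e)) (square-cancel-≤ em 0≤x (≤-reflexive (sym e)))

  -- For a point of the unit circle in the upper half plane, the point in the first quadrant
  -- with half its angle, by the half-angle formulas for cosine and sine.
  halfAngle : Point → Point
  halfAngle (c , _) = √ (½ * (1# + c)) , √ (½ * (1# - c))

  module _ {c s : ℝ} (0≤s : 0# ≤ s) (unit : norm² (c , s) ≈ 1#) where
    private
      a = √ (½ * (1# + c))
      b = √ (½ * (1# - c))
      0≤a : 0# ≤ a
      0≤a = √-nonNeg _
      0≤b : 0# ≤ b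
      0≤b = √-nonNeg _
      bounds = square≤1⇒bounds (unit⇒square≤1 c s unit)
      a² : a * a ≈ ½ * (1# + c)
      a² = √-square em (*-nonNeg (proj₁ 0<½) (proj₁ bounds))
      b² : b * b ≈ ½ * (1# - c)
      b² = √-square em (*-nonNeg (proj₁ 0<½) (proj₂ bounds))

    halfAngle-unit : norm² (halfAngle (c , s)) ≈ 1#
    halfAngle-unit = trans (+-cong a² b²) (trans (regroup ½ c) ½+½≈1)
      where
      regroup : ∀ h c → h * (1# + c) + h * (1# - c) ≈ h + h
      regroup = solve 2 (λ h c → h :* (one :+ c) :+ h :* (one :- c) := h :+ h) refl

    halfAngle-square : halfAngle (c , s) ⊛ halfAngle (c , s) ≋ (c , s)
    halfAngle-square =
      trans (+-cong a² (-‿cong b²))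
        (trans (difference ½ c) (trans (*-congʳ ½+½≈1) (*-identityˡ c))) ,
      -- 2 a b and s are nonnegative and have the same square.
      square-injective (+-nonNeg (*-nonNeg 0≤a 0≤b) (*-nonNeg 0≤b 0≤a)) 0≤s
        (trans (double a b) (trans (*-cong (+-cong a² a²) (+-cong b² b²))
          (trans (product ½ c) (trans (*-cong (*-cong ½+½≈1 ½+½≈1) (+-congʳ (sym unit)))
            (finish c s)))))
      where
      difference : ∀ h c → h * (1# + c) - h * (1# - c) ≈ (h + h) * c
      difference = solve 2 (λ h c → h :* (one :+ c) :- h :* (one :- c) := (h :+ h) :* c) refl
      double : ∀ a b → (a * b + b * a) * (a * b + b * a) ≈ (a * a + a * a) * (b * b + b * b)
      double = solve 2 (λ a b → (a :* b :+ b :* a) :* (a :* b :+ b :* a)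
        := (a :* a :+ a :* a) :* (b :* b :+ b :* b)) refl
      product : ∀ h c → (h * (1# + c) + h * (1# + c)) * (h * (1# - c) + h * (1# - c)) ≈
                        ((h + h) * (h + h)) * (1# - c * c)
      product = solve 2 (λ h c →
        (h :* (one :+ c) :+ h :* (one :+ c)) :* (h :* (one :- c) :+ h :* (one :- c))
        := ((h :+ h) :* (h :+ h)) :* (one :- c :* c)) refl
      finish : ∀ c s → (1# * 1#) * (c * c + s * s - c * c) ≈ s * s
      finish = solve 2 (λ c s → (one :* one) :* (c :* c :+ s :* s :- c :* c) := s :* s) refl

    -- Halving the angle at least halves 1 - cos: with a the new cosine, 1 - c is twice
    -- (1 - a) * (1 + a), and a is nonnegative.
    halfAngle-near : (1# - Re (halfAngle (c , s))) + (1# - Re (halfAngle (c , s))) ≤ 1# - c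
    halfAngle-near = ≤-respʳ
      (trans (+-cong gap gap) (halves (1# - c)))
      (+-mono-≤ 1-a≤ 1-a≤)
      where
      gap : 1# - a * a ≈ ½ * (1# - c)
      gap = trans (+-congʳ (sym halfAngle-unit))
        (trans (solve 2 (λ x y → (x :+ y) :- x := y) refl (a * a) (b * b)) b²)
      a≤1 : 0# ≤ 1# - a
      a≤1 = proj₂ (square≤1⇒bounds (unit⇒square≤1 a b halfAngle-unit))
      1-a≤ : 1# - a ≤ 1# - a * a
      1-a≤ = ≤-by (*-nonNeg 0≤a a≤1) (factor a)
        where
        factor : ∀ a → a * (1# - a) ≈ (1# - a * a) - (1# - a)
        factor = solve 1 (λ a → a :* (one :- a) := (one :- a :* a) :- (one :- a)) refl

  halve-root : ∀ {ω σ} → Root ω σ → Root ω (halfAngle σ)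
  halve-root {ω} {σ} root = record
    { upper    = √-nonNeg _
    ; unit     = halfAngle-unit upper unit
    ; exponent = exponent ℕ.* 2
    ; power    = ≋-trans (pow-* (halfAngle σ) exponent 2)
        (≋-trans (pow-cong exponent (≋-trans (⊛-cong ≋-refl (⊛-identityʳ (halfAngle σ)))
                                             (halfAngle-square upper unit)))
          power)
    }
    where open Root root

  -- The infimum g of 1 - cos over all roots satisfies 2 g ≤ g, as every root can be halved.
  small-root : ∀ {ω} → 0# ≤ proj₂ ω → norm² ω ≈ 1# → ∀ {κ} → 0# < κ →
               ∃[ σ ] (Root ω σ × 1# - Re σ ≤ κ)
  small-root {ω} upper unit {κ} 0<κ =
    let (h , (σ , root , e) , h≤) = proj₂ (proj₂ inf) κ 0<κ
    in σ , root , ≤-respˡ e (≤-trans h≤ (≤-respʳ (+-identityˡ κ) (+-mono-≤ g≤0 ≤-refl)))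
    where
    Gap : Pred ℝ 0ℓ
    Gap h = ∃[ σ ] (Root ω σ × h ≈ 1# - Re σ)
    gap-nonNeg : ∀ h → Gap h → 0# ≤ h
    gap-nonNeg h ((c , s) , root , e) = ≤-respʳ (sym e)
      (proj₂ (square≤1⇒bounds (unit⇒square≤1 c s (Root.unit root))))
    self : Root ω ω
    self = record { upper = upper ; unit = unit ; exponent = 1 ; power = ⊛-identityʳ ω }
    inf = infimum Gap (1# - Re ω , ω , self , refl) 0# gap-nonNeg
    g = proj₁ inf
    g≤ = proj₁ (proj₂ inf)
    double-below : ∀ h → Gap h → g + g ≤ h
    double-below h (σ , root , e) = ≤-respʳ (sym e)
      (≤-trans (+-mono-≤ below below) (halfAngle-near (Root.upper root) (Root.unit root)))
      where
      below : g ≤ 1# - Re (halfAngle σ)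
      below = g≤ _ (halfAngle σ , halve-root root , refl)
    g≤0 : g ≤ 0#
    g≤0 = x+x≤x⇒x≤0 (≤-limit λ ε 0<ε →
      let (h , Gh , h≤) = proj₂ (proj₂ inf) ε 0<ε in ≤-trans (double-below h Gh) h≤)

-- Uncolourable sets of points on a circle

module Circle (R : Reals) (em : ExcludedMiddle 0ℓ) where
  open Reals R
  open RealProperties R
  open SquareRoot R
  open PlaneWidth R
  open IntegerSolver commutativeRing
  open Order R em
  open Distance R em
  open DistanceGraph R em
  open Rotation R em

  -- The rotation by 2π/(n + 2) is the case of interest for ω.  All that is used of it is
  -- Re-≤: the powers of ω with exponents up to n + 1 are at least as far from 1 as ω is.
  -- The last hypothesis says that the points ρ and ρ ω have distance more than 1.
  module _ {ω : Point} (upper : 0# ≤ proj₂ ω) (unit : norm² ω ≈ 1#)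
           (n : ℕ) (Re-≤ : ∀ k → k ℕ.< suc n → Re (pow ω (suc k)) ≤ Re ω)
           (ρ : ℝ) (1<ρ²D : 1# < (ρ * ρ) * (2# - (Re ω + Re ω))) where
    private
      -- By how much the cosine c may be exceeded, without the distance dropping below 1, is
      -- η: a chord with cosine x has squared length ρ² (2 - 2 x), which is 1 for x = c + η.
      c D e A η : ℝ
      c = Re ω
      D = 2# - (c + c)
      e = (ρ * ρ) * D - 1#
      A = ρ * ρ + ρ * ρ
      η = e * A ⁻¹

      0<ρ² : 0# < ρ * ρ
      0<ρ² = square-nonNeg ρ , λ 0≈ρ² → <⇒≱ 1<ρ²D
        (≤-respˡ (trans (sym (zeroˡ D)) (*-congʳ 0≈ρ²)) 0≤1)

      0<A : 0# < A
      0<A = <-≤-trans 0<ρ² (x≤x+y (proj₁ 0<ρ²))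

      0<e : 0# < e
      0<e = 0<y-x 1<ρ²D

      0<η : 0# < η
      0<η = *-pos 0<e (⁻¹-pos 0<A)

      ηA≈e : η * A ≈ e
      ηA≈e = ⁻¹-*-cancel e (>0⇒≉0 0<A)

      margin : ∀ {x} → x ≤ c + η → 1# ≤ (ρ * ρ) * (2# - (x + x))
      margin {x} x≤ = ≤-by (*-nonNeg (proj₁ 0<A) (0≤x-y x≤))
        (trans (expand ρ c η x)
          (trans (+-congˡ (trans (+-congʳ ηA≈e) (-‿inverseʳ e))) (+-identityʳ _)))
        where
        expand : ∀ ρ c η x → (ρ * ρ + ρ * ρ) * (c + η - x) ≈
                 ((ρ * ρ) * (2# - (x + x)) - 1#) +
                 (η * (ρ * ρ + ρ * ρ) - ((ρ * ρ) * (2# - (c + c)) - 1#))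
        expand = solve 4 (λ ρ c η x → (ρ :* ρ :+ ρ :* ρ) :* (c :+ η :- x) :=
          ((ρ :* ρ) :* ((one :+ one) :- (x :+ x)) :- one) :+
          (η :* (ρ :* ρ :+ ρ :* ρ) :- ((ρ :* ρ) :* ((one :+ one) :- (c :+ c)) :- one))) refl

      -- The bound on 1 - cos is the one that makes z ∙ w ≤ Re w + η.
      rotation = small-root upper unit (half-pos (*-pos 0<η 0<η))
      σ = proj₁ rotation
      open Root (proj₁ (proj₂ rotation)) renaming (unit to σ-unit; exponent to M; upper to σ-upper)

      P : ℕ → Point
      P i = (ρ , 0#) ⊛ pow σ i

      norm²-P : ∀ i → norm² (P i) ≈ ρ * ρ
      norm²-P i = trans (norm²-⊛ (ρ , 0#) (pow σ i)) (trans (*-congˡ (norm²-pow σ-unit i))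
        (solve 1 (λ ρ → (ρ :* ρ :+ nil :* nil) :* one := ρ :* ρ) refl ρ))

      P-+ : ∀ i j → P (i ℕ.+ j) ≋ P i ⊛ pow σ j
      P-+ i j = ≋-trans (⊛-cong ≋-refl (pow-+ σ i j)) (≋-sym (⊛-assoc _ _ _))

      P-multiple : ∀ i k → P (i ℕ.+ k ℕ.* M) ≋ P i ⊛ pow ω k
      P-multiple i k = ≋-trans (P-+ i (k ℕ.* M))
        (⊛-cong ≋-refl (≋-trans (pow-* σ k M) (pow-cong k power)))

      P-suc : ∀ i → P (suc i) ≋ P i ⊛ σ
      P-suc i = ≋-trans (⊛-cong ≋-refl (⊛-comm σ (pow σ i))) (≋-sym (⊛-assoc _ _ _))

      far : ∀ {u w x y} i → norm² u ≈ 1# → norm² w ≈ 1# → u ∙ w ≤ c + η →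
            x ≋ P i ⊛ u → y ≋ P i ⊛ w → 1# ≤ dist x y
      far {u} {w} {x} {y} i u-unit w-unit u∙w≤ ex ey = dist-≥1 x y (≤-respʳ
        (sym (trans (sqDist-cong ex ey) (trans (sqDist-⊛ (P i) u w)
          (*-cong (norm²-P i) (sqDist-unit u w u-unit w-unit)))))
        (margin u∙w≤))

      𝟙∙ : ∀ w → Re w ≈ 𝟙 ∙ w
      𝟙∙ (x , y) = solve 2 (λ x y → x := one :* x :+ nil :* y) refl x y

      multiple : ∀ i k → k ℕ.< suc n → 1# ≤ dist (P i) (P (i ℕ.+ suc k ℕ.* M))
      multiple i k k<n = far i norm²-𝟙 (norm²-pow unit (suc k))
        (≤-respˡ (𝟙∙ (pow ω (suc k))) (≤-trans (Re-≤ k k<n) (x≤x+y (proj₁ 0<η))))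
        (≋-sym (⊛-identityʳ (P i))) (P-multiple i (suc k))

      multiple⁻ : ∀ i k → k ℕ.< suc n → 1# ≤ dist (P (suc i)) (P (i ℕ.+ suc k ℕ.* M))
      multiple⁻ i k k<n = far i σ-unit (norm²-pow unit (suc k))
        (≤-trans (∙-near-𝟙 σ (pow ω (suc k)) 0<η σ-unit (norm²-pow unit (suc k))
            (≤-respʳ (halves (η * η)) (+-mono-≤ 1-σ≤ 1-σ≤)))
          (≤-respˡ (+-comm η _) (≤-respʳ (+-comm η c) (+-monoʳ-≤ η (Re-≤ k k<n)))))
        (P-suc i) (P-multiple i (suc k))
        where 1-σ≤ = proj₂ (proj₂ rotation)

    circle-uncolourable : ∃[ N ] ∃ λ (p : Fin N → Point) → (∀ v → norm² (p v) ≈ ρ * ρ) ×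
                          ¬ Colourable (distanceGraph p) (suc (suc n))
    circle-uncolourable =
      _ , P ∘ toℕ , norm²-P ∘ toℕ , sequence-uncolourable P n M multiple multiple⁻

  -- The unit vector in the closed upper half plane with abscissa c, for c between -1 and 1.
  arc : ℝ → Point
  arc c = c , √ (1# - c * c)

  module _ {c : ℝ} (cc≤1 : c * c ≤ 1#) where
    arc-unit : norm² (arc c) ≈ 1#
    arc-unit = trans (+-congˡ (√-square em (0≤x-y cc≤1))) (+-minus 1# (c * c))

    Re-arc : Re (pow (arc c) 1) ≈ c
    Re-arc = proj₁ (⊛-identityʳ (arc c))

    Re-next : ∀ {t x y} → c + c ≈ t → ∀ k →
              Re (pow (arc c) k) ≈ x → Re (pow (arc c) (suc k)) ≈ y →
              Re (pow (arc c) (2 ℕ.+ k)) ≈ t * y - x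
    Re-next e k f g = trans (Re-recurrence arc-unit k) (+-cong (*-cong e g) (-‿cong f))

  -- What is needed of a regular polygon with n + 2 sides, all of length 1: κ stands for its
  -- circumradius and c for the cosine of the angle that a side subtends at the centre.
  record Polygon (n : ℕ) (c κ : ℝ) : Set where
    field
      cosine     : c * c ≤ 1#
      radius     : 0# ≤ κ
      unit-sides : (κ * κ) * (2# - (c + c)) ≈ 1#
      Re-≤       : ∀ k → k ℕ.< suc n → Re (pow (arc c) (suc k)) ≤ c

    polygon-circle : ∀ {δ} → 0# < δ → ∃[ N ] ∃ λ (p : Fin N → Point) →
                     (∀ v → norm² (p v) ≈ (κ + δ) * (κ + δ)) ×
                     ¬ Colourable (distanceGraph p) (suc (suc n))
    polygon-circle {δ} 0<δ = circle-uncolourable (√-nonNeg _) (arc-unit cosine) n Re-≤ (κ + δ)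
      (<-respʳ (trans (+-congʳ (sym unit-sides)) (expand κ δ D))
        (x<x+y (*-pos (*-pos 0<δ 0<2κ+δ) 0<D)))
      where
      D : ℝ
      D = 2# - (c + c)
      expand : ∀ κ δ D → (κ * κ) * D + (δ * (κ + κ + δ)) * D ≈ ((κ + δ) * (κ + δ)) * D
      expand = solve 3 (λ κ δ D →
        (κ :* κ) :* D :+ (δ :* (κ :+ κ :+ δ)) :* D := ((κ :+ δ) :* (κ :+ δ)) :* D) refl
      0<2κ+δ : 0# < κ + κ + δ
      0<2κ+δ = <-≤-trans 0<δ (≤-respʳ (+-comm δ (κ + κ)) (x≤x+y (+-nonNeg radius radius)))
      0≤1-c : 0# ≤ 1# - c
      0≤1-c = proj₂ (square≤1⇒bounds cosine)
      0<D : 0# < D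
      0<D = ≤-respʳ (solve 1 (λ c →
                (one :- c) :+ (one :- c) := (one :+ one) :- (c :+ c)) refl c)
              (+-nonNeg 0≤1-c 0≤1-c) ,
            λ 0≈D → 1≉0 (trans (sym unit-sides) (trans (*-congˡ (sym 0≈D)) (zeroʳ _)))

  -- The triangle, the square and the hexagon

  ½²≤1 : ½ * ½ ≤ 1#
  ½²≤1 = ≤-trans (½x≤x (proj₁ 0<½)) (≤-respʳ ½+½≈1 (x≤x+y (proj₁ 0<½)))

  triangle : Polygon 1 (- ½) ((√ 3#) ⁻¹)
  triangle = record
    { cosine     = cosine
    ; radius     = ⁻¹-nonNeg √3≉0 (√-nonNeg 3#)
    ; unit-sides = trans (*-congˡ (+-congˡ (-‿cong 2c)))
        (trans (regroup κ) (trans (*-congˡ (sym √3²)) (trans (interchange κ (√ 3#))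
          (trans (*-cong (⁻¹-inverseʳ √3≉0) (⁻¹-inverseʳ √3≉0)) (*-identityˡ 1#)))))
    ; Re-≤       = λ where
        0 _ → ≤-reflexive (Re-arc cosine)
        1 _ → ≤-reflexive (trans (Re-next cosine 2c 0 refl (Re-arc cosine)) Re₂)
        (suc (suc _)) (s≤s (s≤s ()))
    }
    where
    κ : ℝ
    κ = (√ 3#) ⁻¹
    2c : - ½ + - ½ ≈ - 1#
    2c = trans (solve 1 (λ h → :- h :+ :- h := :- (h :+ h)) refl ½) (-‿cong ½+½≈1)
    cosine : - ½ * - ½ ≤ 1#
    cosine = ≤-respˡ (solve 1 (λ h → h :* h := (:- h) :* (:- h)) refl ½) ½²≤1
    0<3 : 0# < 3#
    0<3 = <-≤-trans 0<2 (x≤x+y 0≤1)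
    √3² : √ 3# * √ 3# ≈ 3#
    √3² = √-square em (proj₁ 0<3)
    √3≉0 : ¬ (√ 3# ≈ 0#)
    √3≉0 e = >0⇒≉0 0<3 (trans (sym √3²) (trans (*-congʳ e) (zeroˡ _)))
    regroup : ∀ κ → (κ * κ) * (2# - (- 1#)) ≈ (κ * κ) * 3#
    regroup = solve 1 (λ κ →
      (κ :* κ) :* ((one :+ one) :- (:- one)) := (κ :* κ) :* (one :+ one :+ one)) refl
    interchange : ∀ κ s → (κ * κ) * (s * s) ≈ (s * κ) * (s * κ)
    interchange = solve 2 (λ κ s → (κ :* κ) :* (s :* s) := (s :* κ) :* (s :* κ)) refl
    Re₂ : - 1# * - ½ - 1# ≈ - ½
    Re₂ = trans (+-congˡ (sym 2c))
      (solve 1 (λ h → (:- one) :* (:- h) :+ (:- h :+ :- h) := :- h) refl ½)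

  square : Polygon 2 0# (½ * √ 2#)
  square = record
    { cosine     = cosine
    ; radius     = *-nonNeg (proj₁ 0<½) (√-nonNeg 2#)
    ; unit-sides = trans (regroup ½ (√ 2#)) (trans (*-congˡ (√-square em (proj₁ 0<2)))
        (trans (collect ½) (trans (*-cong ½+½≈1 ½+½≈1) (*-identityˡ 1#))))
    ; Re-≤       = λ where
        0 _ → ≤-reflexive Re₁
        1 _ → ≤-respˡ (sym Re₂) (≤-by 0≤1 (solve 0 (one := nil :- (nil :* nil :- one)) refl))
        2 _ → ≤-reflexive (trans (Re-next cosine 2c 1 Re₁ Re₂)
                (solve 0 (nil :* (nil :* nil :- one) :- nil := nil) refl))
        (suc (suc (suc _))) (s≤s (s≤s (s≤s ())))
    }
    where
    2c : 0# + 0# ≈ 0#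
    2c = +-identityˡ 0#
    cosine : 0# * 0# ≤ 1#
    cosine = ≤-respˡ (sym (zeroˡ 0#)) 0≤1
    Re₁ : Re (pow (arc 0#) 1) ≈ 0#
    Re₁ = Re-arc cosine
    Re₂ : Re (pow (arc 0#) 2) ≈ 0# * 0# - 1#
    Re₂ = Re-next cosine 2c 0 refl Re₁
    regroup : ∀ h s → ((h * s) * (h * s)) * (2# - (0# + 0#)) ≈ ((h * h) * 2#) * (s * s)
    regroup = solve 2 (λ h s → ((h :* s) :* (h :* s)) :* ((one :+ one) :- (nil :+ nil))
      := ((h :* h) :* (one :+ one)) :* (s :* s)) refl
    collect : ∀ h → ((h * h) * 2#) * 2# ≈ (h + h) * (h + h)
    collect = solve 1 (λ h →
      ((h :* h) :* (one :+ one)) :* (one :+ one) := (h :+ h) :* (h :+ h)) refl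

  hexagon : Polygon 4 ½ 1#
  hexagon = record
    { cosine     = ½²≤1
    ; radius     = 0≤1
    ; unit-sides = trans (*-congˡ (+-congˡ (-‿cong ½+½≈1)))
        (solve 0 ((one :* one) :* ((one :+ one) :- one) := one) refl)
    ; Re-≤       = λ where
        0 _ → ≤-reflexive Re₁
        1 _ → ≤-respˡ (sym Re₂) (≤-by 0≤1 (solve 1 (λ h → one := h :- (h :- one)) refl ½))
        2 _ → ≤-respˡ (sym Re₃)
                (≤-by (+-nonNeg 0≤1 0≤½) (solve 1 (λ h → one :+ h := h :- :- one) refl ½))
        3 _ → ≤-respˡ (sym Re₄)
                (≤-by (+-nonNeg 0≤½ 0≤½) (solve 1 (λ h → h :+ h := h :- :- h) refl ½))
        4 _ → ≤-reflexive Re₅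
        (suc (suc (suc (suc (suc _))))) (s≤s (s≤s (s≤s (s≤s (s≤s ())))))
    }
    where
    0≤½ : 0# ≤ ½
    0≤½ = proj₁ 0<½
    Re₁ : Re (pow (arc ½) 1) ≈ ½
    Re₁ = Re-arc ½²≤1
    Re₂ : Re (pow (arc ½) 2) ≈ ½ - 1#
    Re₂ = trans (Re-next ½²≤1 ½+½≈1 0 refl Re₁) (solve 1 (λ h → one :* h :- one := h :- one) refl ½)
    Re₃ : Re (pow (arc ½) 3) ≈ - 1#
    Re₃ = trans (Re-next ½²≤1 ½+½≈1 1 Re₁ Re₂)
      (solve 1 (λ h → one :* (h :- one) :- h := :- one) refl ½)
    Re₄ : Re (pow (arc ½) 4) ≈ - ½
    Re₄ = trans (Re-next ½²≤1 ½+½≈1 2 Re₂ Re₃)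
      (solve 1 (λ h → one :* (:- one) :- (h :- one) := :- h) refl ½)
    Re₅ : Re (pow (arc ½) 5) ≈ ½
    Re₅ = trans (Re-next ½²≤1 ½+½≈1 3 Re₃ Re₄)
      (trans (solve 1 (λ h → one :* (:- h) :- (:- one) := one :- h) refl ½)
      (trans (+-congʳ (sym ½+½≈1)) (solve 1 (λ h → (h :+ h) :- h := h) refl ½)))

  -- Graphs of small plane-width

  module _ {ε : ℝ} (0<ε : 0# < ε) where
    private
      -- A quarter of ε, so that the diameter exceeds 2 κ by half of ε.
      δ : ℝ
      δ = ½ * (½ * ε)
      0<δ : 0# < δ
      0<δ = half-pos (half-pos 0<ε)

    -- Some graph with chromatic number k has plane-width less than b + ε.
    NearlyAttained : ℕ → ℝ → Set₁
    NearlyAttained k b = ∃[ G ] (IsChromaticNumber G k × ∃[ w ] (IsPlaneWidth G w × w < b + ε))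

    nearlyAttained : ∀ {N κ b} (p : Fin N → Point) → 0# ≤ κ → κ + κ ≈ b →
                     (∀ v → norm² (p v) ≤ (κ + δ) * (κ + δ)) →
                     ∀ k → ¬ Colourable (distanceGraph p) k → NearlyAttained (suc k) b
    nearlyAttained {κ = κ} {b} p 0≤κ e p≤ k uncolourable =
      let (G , χ , w , pw , w≤) = chromatic-in-disc p (+-nonNeg 0≤κ (proj₁ 0<δ)) p≤ k uncolourable
      in G , χ , w , pw , ≤-<-trans w≤ diameter<
      where
      double : ∀ κ δ → (κ + κ) + (δ + δ) ≈ (κ + δ) + (κ + δ)
      double = solve 2 (λ κ δ → (κ :+ κ) :+ (δ :+ δ) := (κ :+ δ) :+ (κ :+ δ)) refl
      diameter< : (κ + δ) + (κ + δ) < b + ε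
      diameter< = ≤-<-trans
        (≤-reflexive (trans (sym (double κ δ)) (+-cong e (halves (½ * ε)))))
        (<-respʳ (trans (+-assoc b _ _) (+-congˡ (halves ε))) (x<x+y (half-pos 0<ε)))

    polygon-attained : ∀ {n c κ b} → Polygon n c κ → κ + κ ≈ b → NearlyAttained (3 ℕ.+ n) b
    polygon-attained {n} polygon e =
      let (N , p , p≈ , uncolourable) = polygon-circle 0<δ
      in nearlyAttained p radius e (λ v → ≤-reflexive (p≈ v)) (suc (suc n)) uncolourable
      where open Polygon polygon

    -- The centre of the circle is added to the points, which costs one more colour.
    wheel-attained : ∀ {n c κ b} → Polygon n c κ → 1# ≤ κ → κ + κ ≈ b →
                     NearlyAttained (4 ℕ.+ n) b
    wheel-attained {n} {κ = κ} polygon 1≤κ e =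
      let (N , p , p≈ , uncolourable) = polygon-circle 0<δ
      in nearlyAttained (addOrigin p) radius e
           (λ { zero    → ≤-respˡ (sym (trans (+-cong (zeroˡ 0#) (zeroˡ 0#)) (+-identityˡ 0#)))
                            (square-nonNeg (κ + δ))
              ; (suc v) → ≤-reflexive (p≈ v) })
           (3 ℕ.+ n)
           (addOrigin-uncolourable p (λ v → ≤-respʳ (sym (p≈ v)) 1≤ρ²) uncolourable)
      where
      open Polygon polygon
      1≤ρ : 1# ≤ κ + δ
      1≤ρ = ≤-trans 1≤κ (x≤x+y (proj₁ 0<δ))
      1≤ρ² : 1# ≤ (κ + δ) * (κ + δ)
      1≤ρ² = ≤-trans 1≤ρ (≤-respˡ (*-identityʳ (κ + δ)) (*-monoʳ-≤ (≤-trans 0≤1 1≤ρ) 1≤ρ))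

theorem4p1 :
    ExcludedMiddle 0ℓ → (R : Reals) →
    let open Reals R
        open SquareRoot R using (√)
        open PlaneWidth R using (IsPlaneWidth)
    in
    (ε : ℝ) → 0# < ε →
    (∃[ G ] (IsChromaticNumber G 4 ×
      (∃[ w ] (IsPlaneWidth G w × w < 2# * (√ 3#) ⁻¹ + ε)))) ×
    (∃[ G ] (IsChromaticNumber G 5 ×
      (∃[ w ] (IsPlaneWidth G w × w < √ 2# + ε)))) ×
    (∃[ G ] (IsChromaticNumber G 8 ×
      (∃[ w ] (IsPlaneWidth G w × w < 2# + ε))))
theorem4p1 em R ε 0<ε =
  polygon-attained 0<ε triangle
    (solve 1 (λ κ → κ :+ κ := (one :+ one) :* κ) refl ((√ 3#) ⁻¹)) ,
  polygon-attained 0<ε square (halves (√ 2#)) ,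
  wheel-attained 0<ε hexagon ≤-refl refl
  where
  open Reals R
  open RealProperties R using (≤-refl)
  open SquareRoot R using (√)
  open Order R em using (halves)
  open Circle R em
  open IntegerSolver commutativeRing
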